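{- For all integers $d,k\ge 1$ and every real $\delta>0$ there exists a constant $\tilde c=\tilde c(d,\delta,k)>0$ such that the following holds. Let $n\ge k$, and let $P$ and $\rho$ be sets of $n$ and $k$ points, respectively, each in general position in $\mathbb{R}^d$. Suppose that there exist at least $\delta\binom{n}{k}$ subsets of $k$ elements of $P$ with the same order type as $\rho$. Then there exist pairwise disjoint subsets $X_1,\dots,X_k$ of $P$, each with at least $\tilde c\cdot n$ points, such that for every choice of $x_1\in X_1,\dots,x_k\in X_k$, the point set $\{x_1,\dots,x_k\}$ has the same order type as $\rho$.
   Context: A set of points in $\mathbb{R}^d$ is in general position if no $j\le d+1$ of them lie in a common $(j-2)$-flat (affine subspace of dimension $j-2$). The orientation of a $(d+1)$-tuple of points is $\chi(p_1,\dots,p_{d+1})=\operatorname{sgn}\det M$, where $M$ is the $(d+1)\times(d+1)$ matrix whose $i$-th row is $(1,p_i(1),\dots,p_i(d))$, with $p_i(j)$ the $j$-th coordinate of $p_i$. Two sets $A,B$ of $k$ points in $\mathbb{R}^d$ have the same (unlabelled) order type if there exist bijections $\ell_A:[k]\to A$ and $\ell_B:[k]\to B$, where $[k]=\{1,\dots,k\}$, such that $\chi(\ell_A(i_1),\dots,\ell_A(i_{d+1}))=\chi(\ell_B(i_1),\dots,\ell_B(i_{d+1}))$ for all $1\le i_1<\cdots<i_{d+1}\le k$. -}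

module Defs where

open import Algebra.Bundles using (CommutativeRing; Semiring)
import Algebra.Definitions.RawMonoid as RawMonoidOps
import Algebra.Definitions.RawSemiring as RawSemiringOps
open import Data.Fin.Base using (Fin; zero; suc; toℕ)
import Data.Fin.Base as Fin
open import Data.Fin.Subset using (Subset; _∈_; ∣_∣)
open import Data.Integer.Base using (ℤ; -1ℤ; 0ℤ; 1ℤ)
open import Data.List.Base using (List; length)
open import Data.List.Relation.Unary.All using (All)
open import Data.List.Relation.Unary.Unique.Propositional using (Unique)
open import Data.Nat.Base using (ℕ; zero; suc)
import Data.Nat.Base as ℕ
open import Data.Nat.Combinatorics using (_C_)
open import Data.Product.Base using (Σ-syntax; ∃-syntax; ∃₂; _×_; proj₁)
open import Data.Vec.Functional using (Vector; _∷_; removeAt)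
import Data.Vec.Functional.Relation.Binary.Equality.Setoid as VecEq
open import Function.Base using (_∘_)
open import Function.Bundles using (Bijection; Injection)
open import Function.Definitions using (Injective)
open import Level using (Level; _⊔_) renaming (suc to lsuc)
open import Relation.Binary.Bundles using (Setoid)
import Relation.Binary.Construct.On as On
import Relation.Binary.Construct.StrictToNonStrict as StrictToNonStrict
open import Relation.Binary.Core using (Rel; _Preserves_⟶_)
open import Relation.Binary.Definitions using (tri<; tri≈; tri>)
open import Relation.Binary.PropositionalEquality using (_≡_; setoid)
open import Relation.Binary.Structures using (IsStrictTotalOrder)
open import Relation.Nullary.Negation.Core using (¬_)
open import Relation.Unary using (Pred)

-- The (classical) real numbers, given by the axioms that characterise them up
-- to isomorphism: an Archimedean ordered field in which every Cauchy sequence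
-- converges.

record Reals (c ℓ₁ ℓ₂ : Level) : Set (lsuc (c ⊔ ℓ₁ ⊔ ℓ₂)) where
  infix 4 _<_
  field
    commutativeRing : CommutativeRing c ℓ₁

  open CommutativeRing commutativeRing public

  field
    0≉1     : ¬ 0# ≈ 1#
    inverse : ∀ x → ¬ x ≈ 0# → ∃[ y ] x * y ≈ 1#

    _<_                : Rel Carrier ℓ₂
    isStrictTotalOrder : IsStrictTotalOrder _≈_ _<_
    +-monoˡ-<          : ∀ z {x y} → x < y → x + z < y + z
    *-pos              : ∀ {x y} → 0# < x → 0# < y → 0# < x * y

  open IsStrictTotalOrder isStrictTotalOrder public using (compare)
  open StrictToNonStrict _≈_ _<_ public using (_≤_)
  open RawMonoidOps +-rawMonoid public using (sum)
  open RawSemiringOps (Semiring.rawSemiring semiring) public using (_^_)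

  fromℕ : ℕ → Carrier
  fromℕ n = RawMonoidOps._×_ +-rawMonoid n 1#

  Cauchy : (ℕ → Carrier) → Set (c ⊔ ℓ₂)
  Cauchy s = ∀ ε → 0# < ε →
    ∃[ N ] (∀ m n → N ℕ.≤ m → N ℕ.≤ n → s m < s n + ε)

  _⟶_ : (ℕ → Carrier) → Carrier → Set (c ⊔ ℓ₂)
  s ⟶ l = ∀ ε → 0# < ε →
    ∃[ N ] (∀ n → N ℕ.≤ n → s n < l + ε × l < s n + ε)

  field
    archimedean : ∀ x → ∃[ n ] x < fromℕ n
    complete    : ∀ s → Cauchy s → ∃[ l ] s ⟶ l

  sgn : Carrier → ℤ
  sgn x with compare 0# x
  ... | tri< _ _ _ = 1ℤ
  ... | tri≈ _ _ _ = 0ℤ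
  ... | tri> _ _ _ = -1ℤ

module Geometry {c ℓ₁ ℓ₂ : Level} (R : Reals c ℓ₁ ℓ₂) where

  open Reals R using
    ( Carrier; _≈_; _+_; _*_; -_; 0#; 1#; _≤_; sum; _^_; fromℕ; sgn )
  open VecEq (Reals.setoid R) using (_≋_; ≋-setoid)

  private variable
    a b : Level
    d k m n : ℕ

  Point : ℕ → Set c
  Point d = Vector Carrier d

  Matrix : ℕ → Set c
  Matrix n = Vector (Vector Carrier n) n

  -- Laplace expansion along the first row.
  det : Matrix n → Carrier
  det {zero}  M = 1#
  det {suc n} M = sum λ j →
    (- 1#) ^ toℕ j * M zero j * det (λ i → removeAt (M (suc i)) j)

  χ : (Fin (suc d) → Point d) → ℤ
  χ p = sgn (det (λ i → 1# ∷ p i))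

  -- A set of n points, through an enumeration without repetition.
  PointSet : ℕ → ℕ → Set (c ⊔ ℓ₁)
  PointSet d n = Injection (setoid (Fin n)) (≋-setoid d)

  point : PointSet d n → Fin n → Point d
  point = Injection.to

  range : (Fin n → Point d) → Pred (Point d) ℓ₁
  range p q = ∃[ i ] p i ≋ q

  _↾_ : PointSet d n → Subset n → Pred (Point d) ℓ₁
  (P ↾ S) q = ∃[ i ] (i ∈ S × point P i ≋ q)

  ⟨_⟩ : Pred (Point d) a → Setoid (c ⊔ a) ℓ₁
  ⟨_⟩ {d = d} A = On.setoid (≋-setoid d) (proj₁ {B = A})

  Labelling : ℕ → Pred (Point d) a → Set (c ⊔ ℓ₁ ⊔ a)
  Labelling k A = Bijection (setoid (Fin k)) ⟨ A ⟩

  label : {A : Pred (Point d) a} → Labelling k A → Fin k → Point d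
  label ℓ = proj₁ ∘ Bijection.to ℓ

  -- The labellings force both sets to have exactly k points.
  SameOrderType : ∀ k → Pred (Point d) a → Pred (Point d) b →
                  Set (c ⊔ ℓ₁ ⊔ a ⊔ b)
  SameOrderType {d = d} k A B =
    ∃₂ λ (ℓA : Labelling k A) (ℓB : Labelling k B) →
      ∀ (I : Fin (suc d) → Fin k) → I Preserves Fin._<_ ⟶ Fin._<_ →
      χ (label ℓA ∘ I) ≡ χ (label ℓB ∘ I)

  combination : (Fin m → Carrier) → (Fin m → Point d) → Point d
  combination t v j = sum λ i → t i * v i j

  LinearlyIndependent : (Fin m → Point d) → Set (c ⊔ ℓ₁)
  LinearlyIndependent v =
    ∀ t → combination t v ≋ (λ _ → 0#) → ∀ i → t i ≈ 0#

  record Flat (d m : ℕ) : Set (c ⊔ ℓ₁) where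
    field
      base        : Point d
      direction   : Fin m → Point d
      independent : LinearlyIndependent direction

  _∈ᶠ_ : Point d → Flat d m → Set (c ⊔ ℓ₁)
  q ∈ᶠ F = ∃[ t ] (λ j → base j + combination t direction j) ≋ q
    where open Flat F

  -- Here j = 2 + m. The case j = 1 is void, the (-1)-flat being empty.
  GeneralPosition : PointSet d n → Set (c ⊔ ℓ₁)
  GeneralPosition {d = d} {n = n} P =
    ∀ m → 2 ℕ.+ m ℕ.≤ suc d →
    ∀ (s : Fin (2 ℕ.+ m) → Fin n) → Injective _≡_ _≡_ s →
    ∀ (F : Flat d m) → ¬ (∀ i → point P (s i) ∈ᶠ F)

  AtLeastCopies : Carrier → PointSet d n → PointSet d k → Set (c ⊔ ℓ₁ ⊔ ℓ₂)
  AtLeastCopies {n = n} {k = k} δ P ρ = Σ[ 𝓢 ∈ List (Subset n) ]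
    ( Unique 𝓢
    × All (λ S → ∣ S ∣ ≡ k × SameOrderType k (P ↾ S) (range (point ρ))) 𝓢
    × δ * fromℕ (n C k) ≤ fromℕ (length 𝓢) )

{-# OPTIONS --safe #-}

-- A linear functional f on R^m can be located by multidimensional search
-- (Megiddo): boundedly many queries "what is the sign of f at v?" determine the
-- sign of f on a positive fraction of any finite family of vectors.  Applied to
-- a multilinear form with all vectors but the first one fixed, a query is the
-- same kind of question about a form in one vector less.  Hence, by induction,
-- every product of finite point sets contains a product of positive fractions of
-- its sides on which the sign of the form is constant.
--
-- Doing this for all orientations, and for the coincidences of indices, yields in
-- every box a sub-box of a fixed fraction of its volume consisting either of
-- copies of ρ only or of no copies at all.  Split it off, partition the remainder
-- into k boxes and repeat.  After boundedly many rounds the volume left is too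
-- small to contain half of the copies, so one of the boundedly many sub-boxes of
-- copies has large volume, and therefore large sides.
module Submission where

open import Defs
open import Data.Fin.Base using (Fin; zero; suc; toℕ; punchIn)
import Data.Fin.Base as Fin
import Data.Fin.Properties as Fin
import Data.Fin.Subset as Subset
open import Data.Fin.Subset using (Subset; _∈_; _∩_; ∣_∣; Empty)
open import Data.Fin.Subset.Properties using (⊆-antisym; x∈p∩q⁻)
open import Data.Integer.Base using (ℤ; 0ℤ; 1ℤ; -1ℤ)
import Data.Integer.Base as ℤ
import Data.Integer.Properties as ℤ
open import Data.List.Base
  using (List; []; _∷_; length; map; filter; zip; allFin; cartesianProductWith)
open import Data.List.Membership.Propositional using (find; lose)
  renaming (_∈_ to _∈ˡ_; _∉_ to _∉ˡ_)
open import Data.List.Membership.Propositional.Properties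
  using (∈-filter⁺; ∈-filter⁻; ∈-map⁻; ∈-cartesianProductWith⁺; ∈-allFin)
import Data.List.Membership.DecPropositional as DecMembership
open import Data.List.Properties
  using (filter-all; filter-none; length-map; length-zipWith; length-tabulate; map-cong)
open import Data.List.Relation.Binary.Sublist.Propositional
  using (_⊆_; []; _∷_; _∷ʳ_; ⊆-refl; ⊆-trans; minimum)
open import Data.List.Relation.Binary.Sublist.Propositional.Properties
  using (filter-⊆; map⁺; length-mono-≤)
open import Data.List.Relation.Unary.All using (All; []; _∷_)
import Data.List.Relation.Unary.All as All
import Data.List.Relation.Unary.All.Properties as All
open import Data.List.Relation.Unary.AllPairs using ([]; _∷_)
open import Data.List.Relation.Unary.Any using (here; there)
import Data.List.Relation.Unary.Any as Any
open import Data.List.Relation.Unary.Unique.Propositional using (Unique)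
open import Data.Nat.Base using (ℕ; zero; suc)
import Data.Nat.Base as ℕ
import Data.Nat.Properties as ℕ
open import Data.Product.Base using (Σ-syntax; ∃-syntax; _×_; _,_; proj₁; proj₂)
open import Data.Sum.Base using (_⊎_; inj₁; inj₂)
import Data.Sum.Base as Sum
open import Data.Vec.Base using (Vec; lookup)
import Data.Vec.Base as Vec
import Data.Vec.Properties as Vec
open import Data.Vec.Functional using (Vector; tail)
  renaming (_∷_ to _∷ᵛ_; [] to []ᵛ)
open import Function.Base using (_∘_; flip; id)
open import Function.Bundles using (Bijection; Injection)
open import Function.Definitions using (Injective)
open import Level using (Level; _⊔_)
import Level
open import Relation.Binary.Core using (Rel; _Preserves_⟶_)
import Relation.Binary.Definitions as B
open import Relation.Binary.Definitions using (tri<; tri≈; tri>; DecidableEquality)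
open import Relation.Binary.PropositionalEquality using (_≡_; _≢_; _≗_)
import Relation.Binary.PropositionalEquality as ≡
open import Relation.Binary.Structures using (IsStrictTotalOrder)
open import Relation.Nullary using (¬_; Dec; yes; no; contradiction; ¬?; does)
open import Relation.Nullary.Decidable using (_→-dec_; map′)
open import Relation.Unary using (Pred; Decidable)
open import Relation.Unary.Properties using (U?; ∅?)

-- The boxes live in the full power of the index set of `P`, so they contain tuples with repeated
-- points, on which orientations vanish. This is why homogeneity always concerns the three-valued
-- `sgn`, and why being a copy includes the injectivity of the tuple. The same condition finally
-- yields disjointness: two sides with a common point would allow a repetition inside a box that
-- consists of copies. The search is adaptive, and every answer costs a fraction of each side of the
-- current box. The loss has to be bounded by the dimension and the price of one query alone,
-- whatever the number of vectors and points; hence every existence statement names its constants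
-- before the index types, forms and boxes are introduced. Fractions are stored as natural factors:
-- a loss of `B` means that at least one part in `B` survives. Real numbers are needed only for
-- signs, for replacing `δ` by a natural number, and for turning the last factor into the constant
-- of the theorem.

-- Large sublists and boxes.

module Boxes where

  open ≡ using (refl; sym; trans; cong)

  private variable
    a b p q r : Level
    A I : Set a
    k : ℕ

  -- `B` is the reciprocal of the fraction kept. Sublists, rather than mere containment, keep track
  -- of positions, so that complements and cardinalities can be read off later.
  Large : ℕ → List A → List A → Set _
  Large B xs ys = ys ⊆ xs × length xs ℕ.≤ B ℕ.* length ys

  Large-refl : ∀ {xs : List A} → Large 1 xs xs
  Large-refl {xs = xs} = ⊆-refl , ℕ.≤-reflexive (sym (ℕ.*-identityˡ (length xs)))

  Large-trans : ∀ {B C} {xs ys zs : List A} →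
                Large B xs ys → Large C ys zs → Large (B ℕ.* C) xs zs
  Large-trans {B = B} {C} {zs = zs} (s , l) (s′ , l′) =
    ⊆-trans s′ s ,
    ℕ.≤-trans l (ℕ.≤-trans (ℕ.*-monoʳ-≤ B l′)
      (ℕ.≤-reflexive (sym (ℕ.*-assoc B C (length zs)))))

  Large-mono : ∀ {B C} {xs ys : List A} → B ℕ.≤ C → Large B xs ys → Large C xs ys
  Large-mono {ys = ys} B≤C (s , l) = s , ℕ.≤-trans l (ℕ.*-monoˡ-≤ (length ys) B≤C)

  Box : Set a → ℕ → Set a
  Box A k = Fin k → List A

  LargeBox : ℕ → Box A k → Box A k → Set _
  LargeBox B X Y = ∀ i → Large B (X i) (Y i)

  _∈ᵇ_ : (Fin k → A) → Box A k → Set _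
  x ∈ᵇ X = ∀ i → x i ∈ˡ X i

  ⊆⇒∈ : ∀ {xs ys : List A} → ys ⊆ xs → ∀ {x} → x ∈ˡ ys → x ∈ˡ xs
  ⊆⇒∈ (y ∷ʳ s)    m          = there (⊆⇒∈ s m)
  ⊆⇒∈ (refl ∷ s) (here refl) = here refl
  ⊆⇒∈ (refl ∷ s) (there m)   = there (⊆⇒∈ s m)

  LargeBox-refl : ∀ {X : Box A k} → LargeBox 1 X X
  LargeBox-refl i = Large-refl

  LargeBox-trans : ∀ {B C} {X Y Z : Box A k} →
                   LargeBox B X Y → LargeBox C Y Z → LargeBox (B ℕ.* C) X Z
  LargeBox-trans {B = B} {C} l l′ i = Large-trans {B = B} {C} (l i) (l′ i)

  LargeBox-mono : ∀ {B C} {X Y : Box A k} → B ℕ.≤ C → LargeBox B X Y → LargeBox C X Y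
  LargeBox-mono {B = B} {C} B≤C l i = Large-mono {B = B} {C} B≤C (l i)

  LargeBox-∈ : ∀ {B} {X Y : Box A k} → LargeBox B X Y → ∀ {x} → x ∈ᵇ Y → x ∈ᵇ X
  LargeBox-∈ {B = B} l m i = ⊆⇒∈ (proj₁ (l i)) (m i)

  module _ {P : Pred A p} {Q : Pred A q} {S : Pred A r}
           (P? : Decidable P) (Q? : Decidable Q) (S? : Decidable S) where

    length-filter-⊎ : ∀ xs → (∀ x → x ∈ˡ xs → P x → Q x ⊎ S x) →
      length (filter P? xs) ℕ.≤ length (filter Q? xs) ℕ.+ length (filter S? xs)
    length-filter-⊎ [] cover = ℕ.z≤n
    length-filter-⊎ (x ∷ xs) cover
      with ih ← length-filter-⊎ xs (λ y m → cover y (there m)) | P? x | Q? x | S? x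
    ... | no _  | no _  | no _  = ih
    ... | no _  | no _  | yes _ = ℕ.≤-trans ih (ℕ.+-monoʳ-≤ _ (ℕ.n≤1+n _))
    ... | no _  | yes _ | no _  = ℕ.m≤n⇒m≤1+n ih
    ... | no _  | yes _ | yes _ = ℕ.m≤n⇒m≤1+n (ℕ.≤-trans ih (ℕ.+-monoʳ-≤ _ (ℕ.n≤1+n _)))
    ... | yes _ | yes _ | no _  = ℕ.s≤s ih
    ... | yes _ | yes _ | yes _ = ℕ.s≤s (ℕ.≤-trans ih (ℕ.+-monoʳ-≤ _ (ℕ.n≤1+n _)))
    ... | yes _ | no _  | yes _ = ℕ.≤-trans (ℕ.s≤s ih) (ℕ.≤-reflexive (sym (ℕ.+-suc _ _)))
    ... | yes u | no ¬v | no ¬w with cover x (here refl) u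
    ...   | inj₁ v = contradiction v ¬v
    ...   | inj₂ w = contradiction w ¬w

  module _ {Q : Pred A q} {S : Pred A r} (Q? : Decidable Q) (S? : Decidable S) where

    length-⊎ : ∀ xs → (∀ x → x ∈ˡ xs → Q x ⊎ S x) →
      length xs ℕ.≤ length (filter Q? xs) ℕ.+ length (filter S? xs)
    length-⊎ xs cover = ℕ.≤-trans
      (ℕ.≤-reflexive (cong length (sym (filter-all U? {xs} (All.universal _ xs)))))
      (length-filter-⊎ U? Q? S? xs λ x x∈ _ → cover x x∈)

  module _ {P : Pred A p} {Q : Pred A q} (P? : Decidable P) (Q? : Decidable Q) where

    length-filter-mono : ∀ xs → (∀ x → x ∈ˡ xs → P x → Q x) →
      length (filter P? xs) ℕ.≤ length (filter Q? xs)
    length-filter-mono xs P⇒Q = ℕ.≤-trans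
      (length-filter-⊎ P? Q? ∅? xs λ x x∈ px → inj₁ (P⇒Q x x∈ px))
      (ℕ.≤-reflexive (trans (cong (λ zs → length (filter Q? xs) ℕ.+ length zs)
        (filter-none ∅? {xs} (All.universal (λ _ ()) xs))) (ℕ.+-identityʳ _)))

  module _ {_≺_ : Rel A r} (≺-trans : B.Transitive _≺_) (≺-irrefl : ∀ x → ¬ (x ≺ x))
           (_≺?_ : B.Decidable _≺_) where

    maximal : ∀ {z} xs → z ∈ˡ xs → ∃[ m ] (m ∈ˡ xs × (∀ y → y ∈ˡ xs → ¬ (m ≺ y)))
    maximal (x ∷ [])      _ = x , here refl , λ { y (here refl) → ≺-irrefl x }
    maximal (x ∷ x′ ∷ xs) _ with maximal (x′ ∷ xs) (here refl)
    ... | m , m∈ , max with m ≺? x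
    ...   | yes m≺x = x , here refl , λ
              { y (here refl) → ≺-irrefl x
              ; y (there y∈)  → λ x≺y → max y y∈ (≺-trans m≺x x≺y) }
    ...   | no ¬m≺x = m , there m∈ , λ
              { y (here refl) → ¬m≺x
              ; y (there y∈)  → max y y∈ }

  ≤-half : ∀ {n a b} → n ℕ.≤ a ℕ.+ b → n ℕ.≤ 2 ℕ.* a ⊎ n ℕ.≤ 2 ℕ.* b
  ≤-half {n} {a} {b} n≤ with ℕ.≤-total a b
  ... | inj₁ a≤b = inj₂ (ℕ.≤-trans n≤ (ℕ.+-mono-≤ a≤b (ℕ.m≤m+n b 0)))
  ... | inj₂ b≤a = inj₁ (ℕ.≤-trans n≤ (ℕ.+-monoʳ-≤ a (ℕ.≤-trans b≤a (ℕ.m≤m+n a 0))))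

  zip-proj₁ : ∀ (xs ys : List A) → map proj₁ (zip xs ys) ⊆ xs
  zip-proj₁ []       ys       = []
  zip-proj₁ (x ∷ xs) []       = minimum _
  zip-proj₁ (x ∷ xs) (y ∷ ys) = refl ∷ zip-proj₁ xs ys

  zip-proj₂ : ∀ (xs ys : List A) → map proj₂ (zip xs ys) ⊆ ys
  zip-proj₂ []       ys       = minimum _
  zip-proj₂ (x ∷ xs) []       = []
  zip-proj₂ (x ∷ xs) (y ∷ ys) = refl ∷ zip-proj₂ xs ys

  ∈-zip : ∀ (xs ys : List A) {z} → z ∈ˡ zip xs ys → proj₁ z ∈ˡ xs × proj₂ z ∈ˡ ys
  ∈-zip (x ∷ xs) (y ∷ ys) (here refl) = here refl , here refl
  ∈-zip (x ∷ xs) (y ∷ ys) (there m) with ∈-zip xs ys m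
  ... | l , r = there l , there r

  ≤-quarter : ∀ {n a} b → n ℕ.≤ 2 ℕ.* a → a ℕ.≤ 2 ℕ.* b → n ℕ.≤ 4 ℕ.* b
  ≤-quarter b p q = ℕ.≤-trans p (ℕ.≤-trans (ℕ.*-monoʳ-≤ 2 q) (ℕ.≤-reflexive (sym (ℕ.*-assoc 2 2 b))))

open Boxes

-- Weights on boxes, and extraction of a big good box.

module Counting where

  open import Data.Bool.Base using (if_then_else_)
  open import Data.Fin.Subset using (inside; outside)
  open import Data.List.Base using (tabulate)
  open import Data.Nat.Base using (_+_; _*_; _^_; _≤_; _<_; z≤n; s≤s)
  open import Data.Nat.Combinatorics
    using (_C_; nCk≡nC[n∸k]; nCn≡1; nC1≡n; k>n⇒nCk≡0; nCk+nC[k+1]≡[n+1]C[k+1])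
  open import Data.Nat.ListAction using (sum)
  open import Data.Nat.Properties
  open import Data.Nat.Tactic.RingSolver using (solve-∀)
  open import Data.Vec.Base using ([]; _∷_; here; there)
  open ≡ using (refl; sym; trans; cong; cong₂; subst; module ≡-Reasoning)

  private variable
    A : Set
    k n : ℕ

  count : Box A k → (Vec A k → ℕ) → ℕ
  count {k = zero}  X E = E []
  count {k = suc k} X E = sum (map (λ x → count (tail X) (λ v → E (x ∷ v))) (X zero))

  volume : Box A k → ℕ
  volume X = count X (λ _ → 1)

  sum-mono : ∀ {f g : A → ℕ} xs → (∀ x → x ∈ˡ xs → f x ≤ g x) → sum (map f xs) ≤ sum (map g xs)
  sum-mono []       h = z≤n
  sum-mono (x ∷ xs) h = +-mono-≤ (h x (here refl)) (sum-mono xs λ y m → h y (there m))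

  sum-const : ∀ c (xs : List A) → sum (map (λ _ → c) xs) ≡ length xs * c
  sum-const c []       = refl
  sum-const c (x ∷ xs) = cong (c +_) (sum-const c xs)

  sum-+ : ∀ (f g : A → ℕ) xs → sum (map (λ x → f x + g x) xs) ≡ sum (map f xs) + sum (map g xs)
  sum-+ f g []       = refl
  sum-+ f g (x ∷ xs) = trans (cong (f x + g x +_) (sum-+ f g xs)) (interchange (f x) (g x) _ _)
    where
    interchange : ∀ a b c d → a + b + (c + d) ≡ a + c + (b + d)
    interchange = solve-∀

  count-mono : ∀ (X : Box A k) {E F : Vec A k → ℕ} → (∀ v → lookup v ∈ᵇ X → E v ≤ F v) →
               count X E ≤ count X F
  count-mono {k = zero}  X h = h [] λ ()
  count-mono {k = suc k} X h = sum-mono (X zero) λ x x∈ → count-mono (tail X) λ v v∈ →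
    h (x ∷ v) λ { zero → x∈ ; (suc i) → v∈ i }

  count-0 : ∀ (X : Box A k) → count X (λ _ → 0) ≡ 0
  count-0 {k = zero}  X = refl
  count-0 {k = suc k} X = trans (cong sum (map-cong (λ _ → count-0 (tail X)) (X zero)))
    (trans (sum-const 0 (X zero)) (*-zeroʳ (length (X zero))))

  count-+ : ∀ (X : Box A k) (E F : Vec A k → ℕ) → count X (λ v → E v + F v) ≡ count X E + count X F
  count-+ {k = zero}  X E F = refl
  count-+ {k = suc k} X E F = trans
    (cong sum (map-cong (λ x → count-+ (tail X) (λ v → E (x ∷ v)) (λ v → F (x ∷ v))) (X zero)))
    (sum-+ _ _ (X zero))

  volume-suc : ∀ (X : Box A (suc k)) → volume X ≡ length (X zero) * volume (tail X)
  volume-suc X = sum-const (volume (tail X)) (X zero)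

  volume-large : ∀ {B} (X Y : Box A k) → LargeBox B X Y → volume X ≤ B ^ k * volume Y
  volume-large {k = zero}      X Y lb = ≤-refl
  volume-large {k = suc k} {B} X Y lb = begin
    volume X                                             ≡⟨ volume-suc X ⟩
    length (X zero) * volume (tail X)
      ≤⟨ *-mono-≤ (proj₂ (lb zero)) (volume-large (tail X) (tail Y) (lb ∘ suc)) ⟩
    B * length (Y zero) * (B ^ k * volume (tail Y))
      ≡⟨ lemma B (length (Y zero)) (B ^ k) (volume (tail Y)) ⟩
    B * B ^ k * (length (Y zero) * volume (tail Y))      ≡⟨ cong (B * B ^ k *_) (volume-suc Y) ⟨
    B ^ suc k * volume Y                                 ∎
    where
    open ≤-Reasoning
    lemma : ∀ b l c v → b * l * (c * v) ≡ b * c * (l * v)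
    lemma = solve-∀

  -- The splitting is expressed by its effect on every sum, the only way in which it is used; this
  -- spares reasoning about permutations of lists.
  complement : ∀ {xs ys : List A} → ys ⊆ xs → ∃[ zs ]
    (zs ⊆ xs × (∀ (f : A → ℕ) → sum (map f xs) ≡ sum (map f ys) + sum (map f zs)))
  complement []        = [] , [] , λ f → refl
  complement {ys = ys} (x ∷ʳ s)  with complement s
  ... | zs , s′ , e = x ∷ zs , refl ∷ s′ , λ f → trans (cong (f x +_) (e f)) (swap (f x) (sum (map f ys)) _)
    where
    swap : ∀ a b c → a + (b + c) ≡ b + (a + c)
    swap = solve-∀
  complement {xs = x ∷ _} (refl ∷ s) with complement s
  ... | zs , s′ , e = zs , x ∷ʳ s′ , λ f → trans (cong (f x +_) (e f)) (sym (+-assoc (f x) _ _))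

  infix 4 _⊑_
  _⊑_ : Box A k → Box A k → Set
  Y ⊑ X = ∀ i → Y i ⊆ X i

  -- Sort the tuples of `X` outside `Y` by the first side at which they leave `Y`. The box for side
  -- `i` has the sides of `Y` before `i`, the complement of `Y i` at `i`, and the sides of `X` after
  -- it.
  partition : ∀ (X Y : Box A k) → Y ⊑ X → ∃[ Bs ]
    ( length Bs ≡ k × All (_⊑ X) Bs
    × (∀ E → count X E ≡ count Y E + sum (map (λ B → count B E) Bs)))
  partition {k = zero}  X Y s = [] , refl , [] , λ E → sym (+-identityʳ _)
  partition {A} {suc k} X Y s with complement (s zero) | partition (tail X) (tail Y) (s ∘ suc)
  ... | Z₀ , sub , e | Bs , l , subs , e′ =
    (Z₀ ∷ᵛ tail X) ∷ map (Y zero ∷ᵛ_) Bs ,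
    cong suc (trans (length-map _ Bs) l) ,
    (λ { zero → sub ; (suc i) → ⊆-refl }) ∷
      All.map⁺ (All.map (λ b → λ { zero → s zero ; (suc i) → b i }) subs) ,
    λ E → begin
      sum (map (tl E) (X zero))
        ≡⟨ e (tl E) ⟩
      sum (map (tl E) (Y zero)) + sum (map (tl E) Z₀)
        ≡⟨ cong (_+ sum (map (tl E) Z₀)) (trans (cong sum (map-cong (λ x → e′ (λ v → E (x ∷ v))) (Y zero)))
             (sum-+ _ _ (Y zero))) ⟩
      count Y E + sum (map (λ x → sum (map (λ B → count B (λ v → E (x ∷ v))) Bs)) (Y zero)) + sum (map (tl E) Z₀)
        ≡⟨ cong (λ s → count Y E + s + sum (map (tl E) Z₀)) (exchange E Bs) ⟩
      count Y E + sum (map (λ B → count B E) (map (Y zero ∷ᵛ_) Bs)) + sum (map (tl E) Z₀)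
        ≡⟨ trans (+-assoc (count Y E) _ _) (cong (count Y E +_) (+-comm _ (sum (map (tl E) Z₀)))) ⟩
      count Y E + (sum (map (tl E) Z₀) + sum (map (λ B → count B E) (map (Y zero ∷ᵛ_) Bs)))
        ∎
    where
    open ≡-Reasoning
    tl : (Vec A (suc k) → ℕ) → A → ℕ
    tl E x = count (tail X) (λ v → E (x ∷ v))
    exchange : ∀ E Bs → sum (map (λ x → sum (map (λ B → count B (λ v → E (x ∷ v))) Bs)) (Y zero))
                      ≡ sum (map (λ B → count B E) (map (Y zero ∷ᵛ_) Bs))
    exchange E []       = trans (sum-const 0 (Y zero)) (*-zeroʳ (length (Y zero)))
    exchange E (B ∷ Bs) = trans (sum-+ _ _ (Y zero)) (cong (count (Y zero ∷ᵛ B) E +_) (exchange E Bs))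

  -- Iterated splitting.

  -- The number of homogeneous boxes split off in t rounds.
  pieces : ℕ → ℕ → ℕ
  pieces k zero    = 0
  pieces k (suc t) = suc (k * pieces k t)

  module _ {g} {P : ℕ} (E : Vec A k → ℕ) (E≤1 : ∀ v → E v ≤ 1) (Good : Box A k → Set g)
    (dichotomy : ∀ X → ∃[ Y ] (Y ⊑ X × volume X ≤ suc P * volume Y × (Good Y ⊎ count Y E ≡ 0)))
    (R V : ℕ) where

    BigGood : Box A k → Set g
    BigGood X = ∃[ Y ] (Y ⊑ X × Good Y × V ≤ R * volume Y)

    -- count X E ≤ pieces k t * V / R + (P / suc P) ^ t * volume X, without denominators.
    Sparse : ℕ → Box A k → Set
    Sparse t X = R * suc P ^ t * count X E ≤ suc P ^ t * pieces k t * V + R * P ^ t * volume X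

    module _ (t : ℕ) where
      private
        m = suc P ^ t
        p = P ^ t
        N = pieces k t

        all-sparse : ∀ {X} Bs → All (_⊑ X) Bs → (∀ B → BigGood B ⊎ Sparse t B) →
          BigGood X ⊎ R * m * sum (map (λ B → count B E) Bs)
                      ≤ length Bs * (m * N * V) + R * p * sum (map volume Bs)
        all-sparse [] [] ih = inj₂ (≤-trans (≤-reflexive (*-zeroʳ (R * m))) z≤n)
        all-sparse (B ∷ Bs) (s ∷ ss) ih with ih B | all-sparse Bs ss ih
        ... | inj₁ (Y , s′ , g) | _ = inj₁ (Y , (λ i → ⊆-trans (s′ i) (s i)) , g)
        ... | inj₂ _ | inj₁ g = inj₁ g
        ... | inj₂ b | inj₂ bs = inj₂ (begin
          R * m * (count B E + e)
            ≡⟨ *-distribˡ-+ (R * m) (count B E) e ⟩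
          R * m * count B E + R * m * e                                  ≤⟨ +-mono-≤ b bs ⟩
          (m * N * V + R * p * volume B) + (length Bs * (m * N * V) + R * p * v)
            ≡⟨ lemma (m * N * V) (R * p) (volume B) (length Bs) v ⟩
          (m * N * V + length Bs * (m * N * V)) + R * p * (volume B + v) ∎)
          where
          open ≤-Reasoning
          e = sum (map (λ B → count B E) Bs)
          v = sum (map volume Bs)
          lemma : ∀ a b c d e → (a + b * c) + (d * a + b * e) ≡ (a + d * a) + b * (c + e)
          lemma = solve-∀

      -- The box split off carries no weight, or is good; a good box that is not big has volume,
      -- hence weight, at most `V / R`. The other `k` boxes contribute `k * pieces k t` such terms,
      -- and their total volume is at most `P / suc P` of that of `X`.
      sparse-suc : (∀ X → BigGood X ⊎ Sparse t X) → ∀ X → BigGood X ⊎ Sparse (suc t) X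
      sparse-suc ih X with dichotomy X
      ... | Y , s , vol , d with light d
        where
        light : Good Y ⊎ count Y E ≡ 0 → BigGood X ⊎ R * count Y E ≤ V
        light (inj₂ e) = inj₂ (≤-trans (≤-reflexive (trans (cong (R *_) e) (*-zeroʳ R))) z≤n)
        light (inj₁ g) with ≤-total V (R * volume Y)
        ... | inj₁ V≤ = inj₁ (Y , s , g , V≤)
        ... | inj₂ ≤V = inj₂ (≤-trans (*-monoʳ-≤ R (count-mono Y λ v _ → E≤1 v)) ≤V)
      ...   | inj₁ g = inj₁ g
      ...   | inj₂ light with partition X Y s
      ...     | Bs , l , ss , e with all-sparse Bs ss ih
      ...       | inj₁ g = inj₁ g
      ...       | inj₂ b = inj₂ (begin
        R * (suc P * m) * count X E
          ≡⟨ cong (R * (suc P * m) *_) (e E) ⟩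
        R * (suc P * m) * (count Y E + es)
          ≡⟨ lemma₁ R (suc P) m (count Y E) es ⟩
        suc P * m * (R * count Y E) + suc P * (R * m * es)
          ≤⟨ +-mono-≤ (*-monoʳ-≤ (suc P * m) light) (*-monoʳ-≤ (suc P) b) ⟩
        suc P * m * V + suc P * (length Bs * (m * N * V) + R * p * vs)
          ≡⟨ cong (λ j → suc P * m * V + suc P * (j * (m * N * V) + R * p * vs)) l ⟩
        suc P * m * V + suc P * (k * (m * N * V) + R * p * vs)
          ≡⟨ lemma₂ (suc P) m V k N R p vs ⟩
        suc P * m * suc (k * N) * V + R * p * (suc P * vs)
          ≤⟨ +-monoʳ-≤ (suc P * m * suc (k * N) * V) (*-monoʳ-≤ (R * p) shrink) ⟩
        suc P * m * suc (k * N) * V + R * p * (P * volume X)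
          ≡⟨ cong (suc P * m * suc (k * N) * V +_) (lemma₃ R p P (volume X)) ⟩
        suc P * m * suc (k * N) * V + R * (P * p) * volume X ∎)
        where
        open ≤-Reasoning
        es = sum (map (λ B → count B E) Bs)
        vs = sum (map volume Bs)
        lemma₁ : ∀ r q m c e → r * (q * m) * (c + e) ≡ q * m * (r * c) + q * (r * m * e)
        lemma₁ = solve-∀
        lemma₂ : ∀ q m v k n r p s → q * m * v + q * (k * (m * n * v) + r * p * s)
                 ≡ q * m * suc (k * n) * v + r * p * (q * s)
        lemma₂ = solve-∀
        lemma₃ : ∀ r p q v → r * p * (q * v) ≡ r * (q * p) * v
        lemma₃ = solve-∀
        shrink : suc P * vs ≤ P * volume X
        -- Adding `volume X` to both sides replaces the subtraction of `volume Y` from it.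
        shrink = +-cancelˡ-≤ (volume X) _ _ (begin
          volume X + suc P * vs             ≤⟨ +-monoˡ-≤ (suc P * vs) vol ⟩
          suc P * volume Y + suc P * vs     ≡⟨ *-distribˡ-+ (suc P) (volume Y) vs ⟨
          suc P * (volume Y + vs)           ≡⟨ cong (suc P *_) (e (λ _ → 1)) ⟨
          suc P * volume X                  ∎)

    big-or-sparse : ∀ t X → BigGood X ⊎ Sparse t X
    big-or-sparse zero    X = inj₂ (≤-trans
      (*-monoʳ-≤ (R * 1) (count-mono X λ v _ → E≤1 v)) ≤-refl)
    big-or-sparse (suc t) = sparse-suc t (big-or-sparse t)

  -- This is `1 + t / P ≤ (1 + 1 / P) ^ t`, cleared of denominators.
  bernoulli : ∀ P t → (P + t) * P ^ t ≤ P * suc P ^ t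
  bernoulli P zero    = ≤-reflexive (cong (_* 1) (+-identityʳ P))
  bernoulli P (suc t) = begin
    (P + suc t) * (P * P ^ t)     ≤⟨ m≤m+n _ (t * P ^ t) ⟩
    (P + suc t) * (P * P ^ t) + t * P ^ t ≡⟨ lemma P t (P ^ t) ⟩
    suc P * ((P + t) * P ^ t)     ≤⟨ *-monoʳ-≤ (suc P) (bernoulli P t) ⟩
    suc P * (P * suc P ^ t)       ≡⟨ lemma′ (suc P) P (suc P ^ t) ⟩
    P * (suc P * suc P ^ t)       ∎
    where
    open ≤-Reasoning
    lemma : ∀ P t q → (P + suc t) * (P * q) + t * q ≡ suc P * ((P + t) * q)
    lemma = solve-∀
    lemma′ : ∀ a b c → a * (b * c) ≡ b * (a * c)
    lemma′ = solve-∀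

  exponential-growth : ∀ G P → ∃[ t ] G * P ^ t ≤ suc P ^ t
  exponential-growth G zero    = 1 , ≤-trans (≤-reflexive (*-zeroʳ G)) z≤n
  -- For `t = G * P` the Bernoulli bound `1 + t / P` equals `1 + G`.
  exponential-growth G P@(suc _) = G * P , *-cancelˡ-≤ P (begin
    P * (G * P ^ (G * P))      ≡⟨ lemma P G (P ^ (G * P)) ⟩
    G * P * P ^ (G * P)        ≤⟨ *-monoˡ-≤ (P ^ (G * P)) (m≤n+m (G * P) P) ⟩
    (P + G * P) * P ^ (G * P)  ≤⟨ bernoulli P (G * P) ⟩
    P * suc P ^ (G * P)        ∎)
    where
    open ≤-Reasoning
    lemma : ∀ P G q → P * (G * q) ≡ G * P * q
    lemma = solve-∀

  -- The weight has density at least `1 / G`, and the good box obtained fills at least `1 / R` of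
  -- the volume. The type `A` is quantified inside, so `R` is uniform in the number of points.
  ForcesBig : ∀ g → ℕ → ℕ → ℕ → ℕ → Set (Level.suc g)
  ForcesBig g k P G R = ∀ {A : Set} (E : Vec A k → ℕ) → (∀ v → E v ≤ 1) → (Good : Box A k → Set g) →
    (∀ X → ∃[ Y ] (Y ⊑ X × volume X ≤ suc P * volume Y × (Good Y ⊎ count Y E ≡ 0))) →
    ∀ X → 0 < volume X → volume X ≤ G * count X E →
    ∃[ Y ] (Y ⊑ X × Good Y × volume X ≤ R * volume Y)

  dense⇒big : ∀ g k P G → ∃[ R ] ForcesBig g k P G R
  dense⇒big g k P G with exponential-growth (2 * G) P
  ... | t , growth = R , dense
    where
    m = suc P ^ t
    p = P ^ t
    N = pieces k t
    -- After `t` rounds the remainder weighs at most `V / (2 * G)`. If no piece were big, all `N`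
    -- pieces together would weigh at most `N * V / R`, which this choice puts strictly below
    -- `V / (2 * G)`, contradicting the density.
    R = suc (2 * G * N)
    dense : ForcesBig g k P G R
    dense E E≤1 Good dich X 0<V V≤ with big-or-sparse E E≤1 Good dich R (volume X) t X
    ... | inj₁ big = big
    ... | inj₂ sparse = contradiction 2RmV≤ (<⇒≱ gap)
      where
      open ≤-Reasoning
      V = volume X
      e = count X E
      lemma₁ : ∀ r m g e → r * m * (g * e) + r * m * (g * e) ≡ 2 * g * (r * m * e)
      lemma₁ = solve-∀
      lemma₂ : ∀ g m n v r p → 2 * g * (m * n * v + r * p * v) ≡ 2 * g * n * (m * v) + r * (2 * g * p) * v
      lemma₂ = solve-∀
      2RmV≤ : R * m * V + R * m * V ≤ 2 * G * N * (m * V) + R * m * V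
      2RmV≤ = begin
        R * m * V + R * m * V
          ≤⟨ +-mono-≤ (*-monoʳ-≤ (R * m) V≤) (*-monoʳ-≤ (R * m) V≤) ⟩
        R * m * (G * e) + R * m * (G * e)                  ≡⟨ lemma₁ R m G e ⟩
        2 * G * (R * m * e)                                ≤⟨ *-monoʳ-≤ (2 * G) sparse ⟩
        2 * G * (m * N * V + R * p * V)                    ≡⟨ lemma₂ G m N V R p ⟩
        2 * G * N * (m * V) + R * (2 * G * p) * V
          ≤⟨ +-monoʳ-≤ (2 * G * N * (m * V)) (*-monoˡ-≤ V (*-monoʳ-≤ R growth)) ⟩
        2 * G * N * (m * V) + R * m * V                    ∎
      gap : 2 * G * N * (m * V) + R * m * V < R * m * V + R * m * V
      gap = +-monoˡ-< (R * m * V) (begin-strict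
        2 * G * N * (m * V)            <⟨ m<n+m (2 * G * N * (m * V)) (*-mono-≤ (m^n>0 (suc P) t) 0<V) ⟩
        m * V + 2 * G * N * (m * V)    ≡⟨ *-assoc R m V ⟨
        R * m * V                      ∎)

  -- Powers against binomial coefficients, and volumes against sides.

  nC0≡1 : ∀ n → n C 0 ≡ 1
  nC0≡1 n = trans (nCk≡nC[n∸k] {0} {n} z≤n) (nCn≡1 n)

  absorption : ∀ n k → suc k * (suc n C suc k) ≡ suc n * (n C k)
  absorption n zero = begin
    1 * (suc n C 1)   ≡⟨ *-identityˡ _ ⟩
    suc n C 1         ≡⟨ nC1≡n (suc n) ⟩
    suc n             ≡⟨ *-identityʳ (suc n) ⟨
    suc n * 1         ≡⟨ cong (suc n *_) (nC0≡1 n) ⟨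
    suc n * (n C 0)   ∎
    where open ≡-Reasoning
  absorption zero (suc k) = trans
    (cong (suc (suc k) *_) (k>n⇒nCk≡0 {1} {suc (suc k)} (s≤s (s≤s z≤n))))
    (trans (*-zeroʳ (suc (suc k))) (sym (cong (1 *_) (k>n⇒nCk≡0 {0} {suc k} (s≤s z≤n)))))
  absorption (suc n) (suc k) = begin
    suc (suc k) * (suc (suc n) C suc (suc k))
      ≡⟨ cong (suc (suc k) *_) (nCk+nC[k+1]≡[n+1]C[k+1] (suc n) (suc k)) ⟨
    suc (suc k) * (c₁ + c₂)                                   ≡⟨ lemma (suc k) c₁ c₂ ⟩
    c₁ + (suc k * c₁ + suc (suc k) * c₂)
      ≡⟨ cong (c₁ +_) (cong₂ _+_ (absorption n k) (absorption n (suc k))) ⟩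
    c₁ + (suc n * (n C k) + suc n * (n C suc k))
      ≡⟨ cong (c₁ +_) (*-distribˡ-+ (suc n) (n C k) (n C suc k)) ⟨
    c₁ + suc n * (n C k + n C suc k)
      ≡⟨ cong (λ c → c₁ + suc n * c) (nCk+nC[k+1]≡[n+1]C[k+1] n k) ⟩
    suc (suc n) * c₁                                          ∎
    where
    open ≡-Reasoning
    c₁ = suc n C suc k
    c₂ = suc n C suc (suc k)
    lemma : ∀ k a b → suc k * (a + b) ≡ a + (k * a + suc k * b)
    lemma = solve-∀

  -- Bounds `n ^ k / (n C k)` for `n ≥ k`. Passing from `n , k` to `suc n , suc k` costs `suc k` by
  -- `absorption`, and `2 ^ k` for replacing `suc n ^ k` by `n ^ k`.
  powerBound : ℕ → ℕ
  powerBound zero    = 1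
  powerBound (suc k) = 2 ^ k * powerBound k * suc k

  [2+n]^k≤2^k*[1+n]^k : ∀ n k → suc (suc n) ^ k ≤ 2 ^ k * suc n ^ k
  [2+n]^k≤2^k*[1+n]^k n zero    = ≤-refl
  [2+n]^k≤2^k*[1+n]^k n (suc k) = begin
    suc (suc n) * suc (suc n) ^ k         ≤⟨ *-mono-≤ (m≤n+m (suc (suc n)) n) ([2+n]^k≤2^k*[1+n]^k n k) ⟩
    (n + suc (suc n)) * (2 ^ k * suc n ^ k) ≡⟨ lemma n (2 ^ k) (suc n ^ k) ⟩
    2 ^ suc k * suc n ^ suc k             ∎
    where
    open ≤-Reasoning
    lemma : ∀ n a b → (n + suc (suc n)) * (a * b) ≡ 2 * a * (suc n * b)
    lemma = solve-∀

  [1+n]^k≤2^k*n^k : ∀ {n k} → k ≤ n → suc n ^ k ≤ 2 ^ k * n ^ k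
  [1+n]^k≤2^k*n^k {n}     {zero} _ = ≤-refl
  [1+n]^k≤2^k*n^k {suc n} {k}    _ = [2+n]^k≤2^k*[1+n]^k n k

  n^k≤nCk : ∀ {n k} → k ≤ n → n ^ k ≤ powerBound k * (n C k)
  n^k≤nCk {n} {zero} _ = ≤-reflexive (sym (trans (*-identityˡ _) (nC0≡1 n)))
  n^k≤nCk {suc n} {suc k} (s≤s k≤n) = begin
    suc n * suc n ^ k                                    ≤⟨ *-monoʳ-≤ (suc n) ([1+n]^k≤2^k*n^k k≤n) ⟩
    suc n * (2 ^ k * n ^ k)
      ≤⟨ *-monoʳ-≤ (suc n) (*-monoʳ-≤ (2 ^ k) (n^k≤nCk k≤n)) ⟩
    suc n * (2 ^ k * (powerBound k * (n C k)))           ≡⟨ lemma (suc n) (2 ^ k) (powerBound k) (n C k) ⟩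
    2 ^ k * powerBound k * (suc n * (n C k))
      ≡⟨ cong (2 ^ k * powerBound k *_) (absorption n k) ⟨
    2 ^ k * powerBound k * (suc k * (suc n C suc k))
      ≡⟨ *-assoc (2 ^ k * powerBound k) (suc k) (suc n C suc k) ⟨
    powerBound (suc k) * (suc n C suc k)                 ∎
    where
    open ≤-Reasoning
    lemma : ∀ n t p c → n * (t * (p * c)) ≡ t * p * (n * c)
    lemma = solve-∀

  full : ∀ n → Box (Fin n) k
  full n _ = allFin n

  volume-full : ∀ n k → volume {k = k} (full n) ≡ n ^ k
  volume-full n zero    = refl
  volume-full n (suc k) = trans (volume-suc (full {suc k} n))
    (cong₂ _*_ (length-tabulate {n = n} id) (volume-full n k))

  volume-≤ : ∀ (X : Box A k) → (∀ i → length (X i) ≤ n) → volume X ≤ n ^ k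
  volume-≤ {k = zero}  X l = ≤-refl
  volume-≤ {k = suc k} X l = ≤-trans (≤-reflexive (volume-suc X))
    (*-mono-≤ (l zero) (volume-≤ (tail X) (l ∘ suc)))

  -- No other side exceeds `n`, so a volume comparable with `n ^ suc k` forces every single side to
  -- be comparable with `n`.
  volume-side : ∀ (X : Box A (suc k)) → (∀ i → length (X i) ≤ n) → ∀ i → volume X ≤ length (X i) * n ^ k
  volume-side X l zero = ≤-trans (≤-reflexive (volume-suc X))
    (*-monoʳ-≤ (length (X zero)) (volume-≤ (tail X) (l ∘ suc)))
  volume-side {k = suc k} {n} X l (suc i) = begin
    volume X                                   ≡⟨ volume-suc X ⟩
    length (X zero) * volume (tail X)          ≤⟨ *-mono-≤ (l zero) (volume-side (tail X) (l ∘ suc) i) ⟩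
    n * (length (X (suc i)) * n ^ k)           ≡⟨ lemma n (length (X (suc i))) (n ^ k) ⟩
    length (X (suc i)) * (n * n ^ k)           ∎
    where
    open ≤-Reasoning
    lemma : ∀ a b c → a * (b * c) ≡ b * (a * c)
    lemma = solve-∀

  ∈⇒≤sum : ∀ (f : A → ℕ) {x} {xs} → x ∈ˡ xs → f x ≤ sum (map f xs)
  ∈⇒≤sum f (here refl) = m≤m+n _ _
  ∈⇒≤sum f (there x∈)  = ≤-trans (∈⇒≤sum f x∈) (m≤n+m _ _)

  ∈⇒≤count : ∀ (X : Box A k) (E : Vec A k → ℕ) v → lookup v ∈ᵇ X → E v ≤ count X E
  ∈⇒≤count X E []      v∈ = ≤-refl
  ∈⇒≤count X E (x ∷ v) v∈ = ≤-trans (∈⇒≤count (tail X) (λ v → E (x ∷ v)) v (v∈ ∘ suc))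
    (∈⇒≤sum (λ x → count (tail X) (λ v → E (x ∷ v))) (v∈ zero))

  -- From lists to weights, and from sublists to subsets.

  module _ (_≟_ : DecidableEquality A) where

    multiplicity : List A → A → ℕ
    multiplicity []       v = 0
    multiplicity (w ∷ ws) v = (if does (w ≟ v) then 1 else 0) + multiplicity ws v

    multiplicity-∉ : ∀ {ws v} → v ∉ˡ ws → multiplicity ws v ≡ 0
    multiplicity-∉ {[]}         v∉ = refl
    multiplicity-∉ {w ∷ ws} {v} v∉ with w ≟ v
    ... | yes refl = contradiction (here refl) v∉
    ... | no _     = multiplicity-∉ (v∉ ∘ there)

    multiplicity-unique : ∀ {ws} → Unique ws → ∀ v → multiplicity ws v ≤ 1
    multiplicity-unique []                 v = z≤n
    multiplicity-unique {w ∷ ws} (w∉ ∷ u) v with w ≟ v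
    ... | yes refl = ≤-reflexive (cong suc (multiplicity-∉ λ w∈ → All.lookup w∉ w∈ refl))
    ... | no _     = multiplicity-unique u v

    indicator-self : ∀ w → 1 ≤ (if does (w ≟ w) then 1 else 0)
    indicator-self w with w ≟ w
    ... | yes _ = ≤-refl
    ... | no ≢  = contradiction refl ≢

  -- Every listed tuple contributes at least 1 at its own place in the box.
  count-multiplicity : ∀ (_≟_ : DecidableEquality (Vec A k)) (X : Box A k) ws →
    (∀ w → w ∈ˡ ws → lookup w ∈ᵇ X) → length ws ≤ count X (multiplicity _≟_ ws)
  count-multiplicity _≟_ X []       h = z≤n
  count-multiplicity _≟_ X (w ∷ ws) h = ≤-trans
    (+-mono-≤ (≤-trans (indicator-self _≟_ w)
                       (∈⇒≤count X (λ v → if does (w ≟ v) then 1 else 0) w (h w (here refl))))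
              (count-multiplicity _≟_ X ws λ v → h v ∘ there))
    (≤-reflexive (sym (count-+ X _ (multiplicity _≟_ ws))))

  -- The derivation of the sublist relation says, position by position, what is kept; reading the
  -- subset off from it makes its cardinality the length of `ys`.
  toSubset : ∀ {n} (f : Fin n → A) {ys} → ys ⊆ tabulate f → Subset n
  toSubset {n = zero}  f []       = []
  toSubset {n = suc _} f (_ ∷ʳ s) = outside ∷ toSubset (f ∘ suc) s
  toSubset {n = suc _} f (_ ∷ s)  = inside ∷ toSubset (f ∘ suc) s

  ∣toSubset∣ : ∀ {n} (f : Fin n → A) {ys} (s : ys ⊆ tabulate f) → ∣ toSubset f s ∣ ≡ length ys
  ∣toSubset∣ {n = zero}  f []       = refl
  ∣toSubset∣ {n = suc _} f (_ ∷ʳ s) = ∣toSubset∣ (f ∘ suc) s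
  ∣toSubset∣ {n = suc _} f (_ ∷ s)  = cong suc (∣toSubset∣ (f ∘ suc) s)

  ∈-toSubset : ∀ {n} (f : Fin n → A) {ys} (s : ys ⊆ tabulate f) {i} → i ∈ toSubset f s → f i ∈ˡ ys
  ∈-toSubset {n = suc _} f (_ ∷ʳ s)   (there i∈) = ∈-toSubset (f ∘ suc) s i∈
  ∈-toSubset {n = suc _} f (refl ∷ s) here       = here refl
  ∈-toSubset {n = suc _} f (refl ∷ s) (there i∈) = there (∈-toSubset (f ∘ suc) s i∈)

open Counting

module _ {c ℓ₁ ℓ₂ : Level} (R : Reals c ℓ₁ ℓ₂) where

  open Reals R hiding (zero)
  open Geometry R
  open IsStrictTotalOrder isStrictTotalOrder
    using (irrefl; _<?_; _≟_; <-resp-≈) renaming (trans to <-trans)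
  open import Algebra.Properties.CommutativeMonoid.Sum +-commutativeMonoid using (∑-distrib-+)
  open import Algebra.Properties.Group +-group using (x∙y⁻¹≈ε⇒x≈y)
  open import Algebra.Properties.Monoid.Sum +-monoid using (sum-cong-≋)
  open import Algebra.Properties.Ring ring
    using (-‿distribˡ-*; -‿distribʳ-*; -1*x≈-x; -‿involutive)
  open import Algebra.Properties.Semiring.Mult semiring using (×1-homo-*)
  open import Algebra.Properties.Semiring.Sum semiring using (*-distribˡ-sum)
  open import Algebra.Solver.Ring.NaturalCoefficients.Default commutativeSemiring
    using (solve; _:=_; _:+_; _:*_)
  open import Data.Nat.Combinatorics using (_C_)
  open import Data.Vec.Base using (tabulate)
  import Relation.Binary.Reasoning.Setoid setoid as ≈

  private variable
    d k m n D : ℕ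

  -- Signs in an ordered field.

  <-respˡ : ∀ {x y z} → x ≈ y → x < z → y < z
  <-respˡ x≈y = proj₂ <-resp-≈ x≈y
  <-respʳ : ∀ {x y z} → x ≈ y → z < x → z < y
  <-respʳ x≈y = proj₁ <-resp-≈ x≈y

  sgn-pos : ∀ {x} → 0# < x → sgn x ≡ 1ℤ
  sgn-pos {x} 0<x with compare 0# x
  ... | tri< _ _ _ = ≡.refl
  ... | tri≈ ¬< _ _ = contradiction 0<x ¬<
  ... | tri> ¬< _ _ = contradiction 0<x ¬<

  sgn-zero : ∀ {x} → x ≈ 0# → sgn x ≡ 0ℤ
  sgn-zero {x} x≈0 with compare 0# x
  ... | tri< _ ¬≈ _ = contradiction (sym x≈0) ¬≈
  ... | tri≈ _ _ _  = ≡.refl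
  ... | tri> _ ¬≈ _ = contradiction (sym x≈0) ¬≈

  sgn-neg : ∀ {x} → x < 0# → sgn x ≡ -1ℤ
  sgn-neg {x} x<0 with compare 0# x
  ... | tri< _ _ ¬> = contradiction x<0 ¬>
  ... | tri≈ _ _ ¬> = contradiction x<0 ¬>
  ... | tri> _ _ _  = ≡.refl

  -- An inductive form of `sgn x ≡ s`: matching on it reveals the integer and the inequality
  -- together.
  data Sign (x : Carrier) : ℤ → Set (ℓ₁ Level.⊔ ℓ₂) where
    pos  : 0# < x → Sign x 1ℤ
    null : x ≈ 0# → Sign x 0ℤ
    neg  : x < 0# → Sign x -1ℤ

  sign : ∀ x → Sign x (sgn x)
  sign x with compare 0# x
  ... | tri< 0<x _ _ = pos 0<x
  ... | tri≈ _ 0≈x _ = null (sym 0≈x)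
  ... | tri> _ _ x<0 = neg x<0

  Sign⇒sgn : ∀ {x s} → Sign x s → sgn x ≡ s
  Sign⇒sgn (pos 0<x)  = sgn-pos 0<x
  Sign⇒sgn (null x≈0) = sgn-zero x≈0
  Sign⇒sgn (neg x<0)  = sgn-neg x<0

  Sign-resp : ∀ {x y s} → x ≈ y → Sign x s → Sign y s
  Sign-resp e (pos p)  = pos (<-respʳ e p)
  Sign-resp e (null p) = null (trans (sym e) p)
  Sign-resp e (neg p)  = neg (<-respˡ e p)

  sgn-cong : ∀ {x y} → x ≈ y → sgn x ≡ sgn y
  sgn-cong {x} {y} e = ≡.sym (Sign⇒sgn (Sign-resp e (sign x)))

  sgn⇒Sign : ∀ {x s} → sgn x ≡ s → Sign x s
  sgn⇒Sign {x} e = ≡.subst (Sign x) e (sign x)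

  Sign-null : ∀ {x} → Sign x 0ℤ → x ≈ 0#
  Sign-null (null e) = e

  sgn≡0⇒≈0 : ∀ {x} → sgn x ≡ 0ℤ → x ≈ 0#
  sgn≡0⇒≈0 = Sign-null ∘ sgn⇒Sign

  x<y⇒0<y-x : ∀ {x y} → x < y → 0# < y + - x
  x<y⇒0<y-x {x} x<y = <-respˡ (-‿inverseʳ x) (+-monoˡ-< (- x) x<y)

  0<y-x⇒x<y : ∀ {x y} → 0# < y + - x → x < y
  0<y-x⇒x<y {x} {y} p = <-respˡ (+-identityˡ x)
    (<-respʳ (trans (+-assoc y (- x) x) (trans (+-congˡ (-‿inverseˡ x)) (+-identityʳ y)))
      (+-monoˡ-< x p))

  neg⇒ : ∀ {x} → x < 0# → 0# < - x
  neg⇒ {x} p = <-respʳ (+-identityˡ (- x)) (x<y⇒0<y-x p)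

  ⇒neg : ∀ {x} → 0# < - x → x < 0#
  ⇒neg {x} p = 0<y-x⇒x<y (<-respʳ (sym (+-identityˡ (- x))) p)

  pos⇒ : ∀ {x} → 0# < x → - x < 0#
  pos⇒ {x} p = ⇒neg (<-respʳ (sym (-‿involutive x)) p)

  +-pos : ∀ {x y} → 0# < x → 0# < y → 0# < x + y
  +-pos {x} {y} p q = <-trans q (<-respˡ (+-identityˡ y) (+-monoˡ-< y p))

  0#*x : ∀ {x y} → x ≈ 0# → x * y ≈ 0#
  0#*x {y = y} e = trans (*-congʳ e) (zeroˡ y)

  *-Sign : ∀ {x y s t} → Sign x s → Sign y t → Sign (x * y) (s ℤ.* t)
  *-Sign (pos p) (pos q)  = pos (*-pos p q)
  *-Sign {x} (pos p) (null q) = null (trans (*-congˡ q) (zeroʳ x))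
  *-Sign {x} {y} (pos p) (neg q)  = neg (⇒neg (<-respʳ (sym (-‿distribʳ-* x y)) (*-pos p (neg⇒ q))))
  *-Sign {t = t} (null p) q = ≡.subst (Sign _) (≡.sym (ℤ.*-zeroˡ t)) (null (0#*x p))
  *-Sign {x} {y} (neg p) (pos q) = neg (⇒neg (<-respʳ (sym (-‿distribˡ-* x y)) (*-pos (neg⇒ p) q)))
  *-Sign {x} (neg p) (null q) = null (trans (*-congˡ q) (zeroʳ x))
  *-Sign {x} {y} (neg p) (neg q) = pos (<-respʳ e (*-pos (neg⇒ p) (neg⇒ q)))
    where
    e = trans (sym (-‿distribˡ-* x (- y)))
          (trans (-‿cong (sym (-‿distribʳ-* x y))) (-‿involutive (x * y)))

  sgn-* : ∀ x y → sgn (x * y) ≡ sgn x ℤ.* sgn y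
  sgn-* x y = Sign⇒sgn (*-Sign (sign x) (sign y))

  +-Sign : ∀ {x y s} → Sign x s → Sign y s → Sign (x + y) s
  +-Sign (pos p)  (pos q)  = pos (+-pos p q)
  +-Sign (null p) (null q) = null (trans (+-cong p q) (+-identityʳ 0#))
  +-Sign {x} {y} (neg p) (neg q) = neg (<-trans (<-respʳ (+-identityˡ y) (+-monoˡ-< y p)) q)

  +-Signˡ : ∀ {x y s} → Sign x s → y ≈ 0# → Sign (x + y) s
  +-Signˡ {x} s e = Sign-resp (sym (trans (+-congˡ e) (+-identityʳ x))) s

  +-Signʳ : ∀ {x y s} → x ≈ 0# → Sign y s → Sign (x + y) s
  +-Signʳ {y = y} e s = Sign-resp (sym (trans (+-congʳ e) (+-identityˡ y))) s

  *-Sign⁺ : ∀ {x y s} → 0# < x → Sign y s → Sign (x * y) s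
  *-Sign⁺ {s = s} p q = ≡.subst (Sign _) (ℤ.*-identityˡ s) (*-Sign (pos p) q)

  Sign-*⁻ : ∀ {x y s} → 0# < x → Sign (x * y) s → sgn y ≡ s
  Sign-*⁻ {x} {y} {s} p q = ≡.trans (≡.sym (ℤ.*-identityˡ _))
    (≡.trans (≡.cong (ℤ._* sgn y) (≡.sym (sgn-pos p))) (≡.trans (≡.sym (sgn-* x y)) (Sign⇒sgn q)))

  0<1 : 0# < 1#
  0<1 with compare 0# 1#
  ... | tri< p _ _ = p
  ... | tri≈ _ e _ = contradiction e 0≉1
  ... | tri> _ _ p = <-respʳ e (*-pos (neg⇒ p) (neg⇒ p))
    where e = trans (-1*x≈-x (- 1#)) (-‿involutive 1#)

  -- Made total by a default value at 0, so that a whole family of vectors can be rescaled although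
  -- only some of them are known to have a nonzero entry.
  inv : Carrier → Carrier
  inv x with x ≟ 0#
  ... | yes _  = 0#
  ... | no x≉0 = proj₁ (inverse x x≉0)

  inv-inverse : ∀ {x} → ¬ x ≈ 0# → x * inv x ≈ 1#
  inv-inverse {x} x≉0 with x ≟ 0#
  ... | yes e   = contradiction e x≉0
  ... | no x≉0′ = proj₂ (inverse x x≉0′)

  -- The factors 1 and -1 stay unreduced because linearity, applied to a difference of two vectors,
  -- produces exactly this term.
  interpolate : ∀ α β u v →
    (α + β) * u ≈ (α * u + β * v) + β * (1# * u + - 1# * v)
  interpolate α β u v = sym (begin
    (α * u + β * v) + β * (1# * u + - 1# * v)        ≈⟨ lemma α β u v 1# (- 1#) ⟩
    (α + β * 1#) * u + (1# + - 1#) * (β * v)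
      ≈⟨ +-cong (*-congʳ (+-congˡ (*-identityʳ β))) (0#*x (-‿inverseʳ 1#)) ⟩
    (α + β) * u + 0#                                  ≈⟨ +-identityʳ _ ⟩
    (α + β) * u                                       ∎)
    where
    open ≈
    lemma : ∀ α β u v o n → (α * u + β * v) + β * (o * u + n * v) ≈ (α + β * o) * u + (1# + n) * (β * v)
    lemma α β u v o n = trans
      (solve 6 (λ α β u v o n → (α :* u :+ β :* v) :+ β :* (o :* u :+ n :* v) :=
       (α :+ β :* o) :* u :+ (β :* v :+ n :* (β :* v))) refl α β u v o n)
      (+-congˡ (sym (trans (distribʳ (β * v) 1# n) (+-congʳ (*-identityˡ (β * v))))))

  interpolate′ : ∀ α β u v →
    (α + β) * v ≈ (α * u + β * v) + α * (- 1# * (1# * u + - 1# * v))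
  interpolate′ α β u v = begin
    (α + β) * v                                       ≈⟨ *-congʳ (+-comm α β) ⟩
    (β + α) * v                                       ≈⟨ interpolate β α v u ⟩
    (β * v + α * u) + α * (1# * v + - 1# * u)         ≈⟨ +-cong (+-comm _ _) (*-congˡ e) ⟩
    (α * u + β * v) + α * (- 1# * (1# * u + - 1# * v)) ∎
    where
    open ≈
    lemma : ∀ u v n → n * (1# * u + n * v) ≈ (n * n) * v + n * u
    lemma u v n = trans (*-congˡ (+-congʳ (*-identityˡ u)))
      (solve 3 (λ u v n → n :* (u :+ n :* v) := (n :* n) :* v :+ n :* u) refl u v n)
    e : 1# * v + - 1# * u ≈ - 1# * (1# * u + - 1# * v)
    e = sym (trans (lemma u v (- 1#)) (+-congʳ (*-congʳ (trans (-1*x≈-x (- 1#)) (-‿involutive 1#)))))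

  -- Medians.

  module _ {I : Set} (b : I → Carrier) (xs : List I) where

    private
      ≼? : ∀ μ i → Dec (¬ μ < b i)
      ≼? μ i = ¬? (μ <? b i)
      ≽? : ∀ μ i → Dec (¬ b i < μ)
      ≽? μ i = ¬? (b i <? μ)
      P : I → Set
      P j = length xs ℕ.≤ 2 ℕ.* length (filter (≼? (b j)) xs)
      P? : ∀ j → Dec (P j)
      P? j = length xs ℕ.≤? 2 ℕ.* length (filter (≼? (b j)) xs)

    -- The least element dominating at least half of the list is a median.
    median : ∀ {z} → z ∈ˡ xs → ∃[ μ ]
      ( length xs ℕ.≤ 2 ℕ.* length (filter (λ i → ¬? (μ <? b i)) xs)
      × length xs ℕ.≤ 2 ℕ.* length (filter (λ i → ¬? (b i <? μ)) xs))
    median z∈ with maximal {_≺_ = λ i j → b i < b j} <-trans (λ _ → irrefl refl) (λ _ _ → _ <? _) xs z∈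
    ... | t , t∈ , t-max
      with maximal {_≺_ = λ i j → b j < b i} (flip <-trans) (λ _ → irrefl refl) (λ _ _ → _ <? _)
             (filter P? xs) (∈-filter⁺ P? t∈ Pt)
      where
      Pt : P t
      Pt = ℕ.≤-trans (ℕ.≤-reflexive (≡.cong length (≡.sym (filter-all (≼? (b t)) (All.tabulate (t-max _))))))
             (ℕ.m≤m+n _ _)
    ... | m , m∈ , m-min with length xs ℕ.≤? 2 ℕ.* length (filter (≽? (b m)) xs)
    ...   | yes p = b m , proj₂ (∈-filter⁻ P? {xs = xs} m∈) , p
    ...   | no ¬p with ≤-half {length xs} {length (filter (λ i → b i <? b m) xs)}
                         (length-⊎ (λ i → b i <? b m) (≽? (b m)) xs λ i _ → case i)
      where
      case : ∀ i → b i < b m ⊎ ¬ b i < b m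
      case i with b i <? b m
      ... | yes q = inj₁ q
      ... | no q  = inj₂ q
    ...     | inj₂ q = contradiction q ¬p
    -- At least half of the list lies strictly below `b m`. The largest of these elements would then
    -- dominate half of the list as well, against the minimality of `m`.
    ...     | inj₁ q with filter (λ i → b i <? b m) xs in eq
    ...       | [] = contradiction (ℕ.≤-trans q ℕ.z≤n) ¬p
    ...       | l ∷ ls
        with maximal {_≺_ = λ i j → b i < b j} <-trans (λ _ → irrefl refl) (λ _ _ → _ <? _)
               (l ∷ ls) (here ≡.refl)
    ...         | m′ , m′∈ , m′-max = contradiction m′<m (m-min m′ (∈-filter⁺ P? (proj₁ m′p) Pm′))
      where
      m′p = ∈-filter⁻ (λ i → b i <? b m) {xs = xs} (≡.subst (m′ ∈ˡ_) (≡.sym eq) m′∈)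
      m′<m = proj₂ m′p
      Pm′ : P m′
      Pm′ = ℕ.≤-trans q (ℕ.*-monoʳ-≤ 2 (ℕ.≤-trans (ℕ.≤-reflexive (≡.cong length (≡.sym eq)))
        (length-filter-mono (λ i → b i <? b m) (≼? (b m′)) xs λ i i∈ bi<bm →
            m′-max i (≡.subst (i ∈ˡ_) eq (∈-filter⁺ (λ i → b i <? b m) i∈ bi<bm)))))

  -- Multidimensional search.

  -- Quantifying over every `w` pointwise equal to the combination builds in that `g` respects
  -- pointwise equality; compare `Linear-cong`.
  Linear : (Vector Carrier m → Carrier) → Set _
  Linear g = ∀ α β u v w → (∀ j → w j ≈ α * u j + β * v j) → g w ≈ α * g u + β * g v

  module _ {g : Vector Carrier m → Carrier} (lin : Linear g) where

    Linear-scale : ∀ α u w → (∀ j → w j ≈ α * u j) → g w ≈ α * g u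
    Linear-scale α u w e = trans
      (lin α 0# u u w λ j → trans (e j) (sym (trans (+-congˡ (zeroˡ _)) (+-identityʳ _))))
      (trans (+-congˡ (zeroˡ _)) (+-identityʳ _))

    Linear-cong : ∀ u w → (∀ j → w j ≈ u j) → g w ≈ g u
    Linear-cong u w e = trans (Linear-scale 1# u w λ j → trans (e j) (sym (*-identityˡ _))) (*-identityˡ _)

  -- Linear embeddings of R^m whose images are the hyperplanes x₀ = 0 and x₁ = μ x₀.
  embed₀ : Vector Carrier m → Vector Carrier (suc m)
  embed₀ u = 0# ∷ᵛ u

  embed : Carrier → Vector Carrier (suc m) → Vector Carrier (suc (suc m))
  embed μ u = u zero ∷ᵛ (μ * u zero ∷ᵛ tail u)

  Linear-embed₀ : ∀ {g : Vector Carrier (suc m) → Carrier} → Linear g → Linear (g ∘ embed₀)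
  Linear-embed₀ lin α β u v w e = lin α β _ _ _ λ
    { zero    → sym (trans (+-cong (zeroʳ α) (zeroʳ β)) (+-identityˡ 0#))
    ; (suc j) → e j }

  Linear-embed : ∀ {g : Vector Carrier (suc (suc m)) → Carrier} μ → Linear g → Linear (g ∘ embed μ)
  Linear-embed μ lin α β u v w e = lin α β _ _ _ λ
    { zero          → e zero
    ; (suc zero)    → trans (*-congˡ (e zero)) (lemma μ α β (u zero) (v zero))
    ; (suc (suc j)) → e (suc j) }
    where
    lemma : ∀ μ α β x y → μ * (α * x + β * y) ≈ α * (μ * x) + β * (μ * y)
    lemma = solve 5 (λ μ α β x y → μ :* (α :* x :+ β :* y) := α :* (μ :* x) :+ β :* (μ :* y)) refl

  module _ {A : Set} {k : ℕ} where

    -- A family of functionals, one for each tuple, is searched simultaneously. One query at `v` is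
    -- answered uniformly after the box of tuples has shrunk by the factor `K`.
    Oracle : ℕ → ((Fin k → A) → Vector Carrier m → Carrier) → Set _
    Oracle K φ = ∀ v X → ∃[ Y ] ∃[ s ]
      (LargeBox K X Y × (∀ y → y ∈ᵇ Y → sgn (φ y v) ≡ s))

    Resolves : ℕ → ℕ → ((Fin k → A) → Vector Carrier m → Carrier) →
               ∀ {I : Set} → (I → Vector Carrier m) → List I → Box A k → Set _
    Resolves L Q φ a xs X = ∃[ ys ] ∃[ Y ] ∃[ s ]
      ( Large L xs ys × LargeBox Q X Y
      × (∀ i → i ∈ˡ ys → ∀ y → y ∈ᵇ Y → sgn (φ y (a i)) ≡ s))

  -- `L` is the loss among the vectors and `Q` the loss on each side of the box. Both depend on `m`
  -- and `K` only, not on the arity `k`.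
  Search : ℕ → Set _
  Search m = ∀ K → ∃[ L ] ∃[ Q ] (∀ {A : Set} {k} (φ : (Fin k → A) → Vector Carrier m → Carrier) →
    (∀ y → Linear (φ y)) → Oracle K φ →
    ∀ {I : Set} (a : I → Vector Carrier m) xs X → Resolves L Q φ a xs X)

  -- With first coordinate 1 the functionals become affine on R^m, and the remaining coordinates of
  -- different vectors can be compared, as taking a median requires.
  Search¹ : ℕ → Set _
  Search¹ m = ∀ K → ∃[ L ] ∃[ Q ] (∀ {A : Set} {k} (φ : (Fin k → A) → Vector Carrier (suc m) → Carrier) →
    (∀ y → Linear (φ y)) → Oracle K φ →
    ∀ {I : Set} (a : I → Vector Carrier (suc m)) xs X → (∀ i → i ∈ˡ xs → a i zero ≈ 1#) →
    Resolves L Q φ a xs X)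

  search-zero : Search 0
  search-zero K = 1 , 1 , λ φ lin oracle a xs X → xs , X , 0ℤ , Large-refl , LargeBox-refl {X = X} ,
    λ i _ y _ → sgn-zero (trans (Linear-scale (lin y) 0# (a i) (a i) λ ()) (zeroˡ _))

  search¹-zero : Search¹ 0
  search¹-zero K = 1 , K , λ φ lin oracle a xs X e →
    let Y , s , lb , eq = oracle (λ _ → 1#) X in
    xs , Y , s , Large-refl , lb , λ i i∈ y y∈ →
      ≡.trans (sgn-cong (Linear-cong (lin y) _ _ λ { zero → e i i∈ })) (eq y y∈)

  -- Vectors with first coordinate 0 belong to R^m. The others are rescaled to first coordinate 1,
  -- which multiplies the value by a factor of known sign. Two halvings leave a class, of one sign
  -- of that coordinate, with at least a quarter of the list: hence the factor 4.
  search-suc : Search m → Search¹ m → Search (suc m)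
  search-suc S S¹ K with S K | S¹ K
  ... | L , Q , r | L¹ , Q¹ , r¹ = 4 ℕ.* (L ℕ.+ L¹) , Q ℕ.+ Q¹ , resolve
    where
    resolve : ∀ {A : Set} {k} (φ : (Fin k → A) → Vector Carrier _ → Carrier) →
      (∀ y → Linear (φ y)) → Oracle K φ →
      ∀ {I : Set} (a : I → Vector Carrier _) xs X → Resolves (4 ℕ.* (L ℕ.+ L¹)) (Q ℕ.+ Q¹) φ a xs X
    resolve φ lin oracle {I} a xs X = cases
      where
      σ : I → ℤ
      σ i = sgn (a i zero)

      class : ℤ → List I
      class s = filter (λ i → σ i ℤ.≟ s) xs

      class∈ : ∀ {s i} → i ∈ˡ class s → σ i ≡ s
      class∈ {s} i∈ = proj₂ (∈-filter⁻ (λ i → σ i ℤ.≟ s) {xs = xs} i∈)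

      finish : ∀ {s B L′ Q′} → B ℕ.≤ 4 → L′ ℕ.≤ L ℕ.+ L¹ → Q′ ℕ.≤ Q ℕ.+ Q¹ →
        length xs ℕ.≤ B ℕ.* length (class s) → Resolves L′ Q′ φ a (class s) X →
        Resolves (4 ℕ.* (L ℕ.+ L¹)) (Q ℕ.+ Q¹) φ a xs X
      finish {s} {B} {L′} {Q′} B≤ L≤ Q≤ n≤ (ys , Y , t , lg , lb , eq) =
        ys , Y , t ,
        Large-mono {B = B ℕ.* L′} (ℕ.*-mono-≤ B≤ L≤)
          (Large-trans {B = B} {L′} (filter-⊆ (λ i → σ i ℤ.≟ s) xs , n≤) lg) ,
        LargeBox-mono {B = Q′} {X = X} {Y} Q≤ lb , eq

      null-case : Resolves L Q φ a (class 0ℤ) X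
      null-case with r (λ y → φ y ∘ embed₀) (λ y → Linear-embed₀ (lin y)) (oracle ∘ embed₀)
                       (tail ∘ a) (class 0ℤ) X
      ... | ys , Y , t , lg , lb , eq = ys , Y , t , lg , lb , λ i i∈ y y∈ →
        ≡.trans (sgn-cong (Linear-cong (lin y) _ _ λ
          { zero → sgn≡0⇒≈0 (class∈ (⊆⇒∈ (proj₁ lg) i∈)) ; (suc j) → refl })) (eq i i∈ y y∈)

      nonzero : ∀ {s i} → s ≢ 0ℤ → i ∈ˡ class s → ¬ a i zero ≈ 0#
      nonzero s≢0 i∈ e = s≢0 (≡.trans (≡.sym (class∈ i∈)) (sgn-zero e))

      unit-case : ∀ s → s ≢ 0ℤ → Resolves L¹ Q¹ φ a (class s) X
      unit-case s s≢0 with r¹ φ lin oracle (λ i j → inv (a i zero) * a i j) (class s) X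
                            (λ i i∈ → trans (*-comm _ _) (inv-inverse (nonzero s≢0 i∈)))
      ... | ys , Y , t , lg , lb , eq = ys , Y , s ℤ.* t , lg , lb , λ i i∈ y y∈ →
        ≡.trans (sgn-cong (Linear-scale (lin y) (a i zero) _ _ λ j → sym
            (trans (sym (*-assoc _ _ _))
              (trans (*-congʳ (inv-inverse (nonzero s≢0 (⊆⇒∈ (proj₁ lg) i∈)))) (*-identityˡ _)))))
          (≡.trans (sgn-* _ _) (≡.cong₂ ℤ._*_ (class∈ (⊆⇒∈ (proj₁ lg) i∈)) (eq i i∈ y y∈)))

      rest? : ∀ i → Dec (σ i ≡ 1ℤ ⊎ σ i ≡ -1ℤ)
      rest? i with σ i ℤ.≟ 1ℤ | σ i ℤ.≟ -1ℤ
      ... | yes p | _     = yes (inj₁ p)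
      ... | no _  | yes q = yes (inj₂ q)
      ... | no ¬p | no ¬q = no λ { (inj₁ p) → ¬p p ; (inj₂ q) → ¬q q }

      trichotomy : ∀ i → σ i ≡ 0ℤ ⊎ (σ i ≡ 1ℤ ⊎ σ i ≡ -1ℤ)
      trichotomy i with sgn (a i zero) | sign (a i zero)
      ... | _ | pos _  = inj₂ (inj₁ ≡.refl)
      ... | _ | null _ = inj₁ ≡.refl
      ... | _ | neg _  = inj₂ (inj₂ ≡.refl)

      L≤ = ℕ.m≤m+n L L¹
      Q≤ = ℕ.m≤m+n Q Q¹
      L¹≤ = ℕ.m≤n+m L¹ L
      Q¹≤ = ℕ.m≤n+m Q¹ Q

      cases : Resolves (4 ℕ.* (L ℕ.+ L¹)) (Q ℕ.+ Q¹) φ a xs X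
      cases with ≤-half {length xs} {length (class 0ℤ)}
                   (length-⊎ (λ i → σ i ℤ.≟ 0ℤ) rest? xs λ i _ → trichotomy i)
      ... | inj₁ n≤ = finish {0ℤ} {2} (ℕ.s≤s (ℕ.s≤s ℕ.z≤n)) L≤ Q≤ n≤ null-case
      ... | inj₂ n≤ with ≤-half {length (filter rest? xs)} {length (class 1ℤ)}
            (length-filter-⊎ rest? (λ i → σ i ℤ.≟ 1ℤ) (λ i → σ i ℤ.≟ -1ℤ) xs λ _ _ p → p)
      ...   | inj₁ m≤ = finish {1ℤ} {4} ℕ.≤-refl L¹≤ Q¹≤
                          (≤-quarter (length (class 1ℤ)) n≤ m≤) (unit-case 1ℤ λ ())
      ...   | inj₂ m≤ = finish { -1ℤ} {4} ℕ.≤-refl L¹≤ Q¹≤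
                          (≤-quarter (length (class -1ℤ)) n≤ m≤) (unit-case -1ℤ λ ())

  -- Let `μ` be a median of the second coordinate. If many vectors attain it, they lie in the
  -- hyperplane x₁ = μ x₀. Otherwise pair vectors above `μ` with vectors not above it: the plane
  -- spanned by a pair meets x₀ = 0 and x₁ = μ x₀ in two directions, which are searched in one
  -- dimension less.
  search¹-suc : Search (suc m) → Search¹ (suc m)
  search¹-suc {m} S K with S K
  -- Either case keeps a quarter of the list, then runs one search (`L`, `Q`) or two nested ones
  -- (`L * L`, `Q * Q`). The `suc` makes the bound at least 1 for the empty list, where the box
  -- stays whole.
  ... | L , Q , r = 4 ℕ.* (L ℕ.+ L ℕ.* L) , suc (Q ℕ.+ Q ℕ.* Q) , resolve
    where
    resolve : ∀ {A : Set} {k} (φ : (Fin k → A) → Vector Carrier _ → Carrier) →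
      (∀ y → Linear (φ y)) → Oracle K φ →
      ∀ {I : Set} (a : I → Vector Carrier _) xs X → (∀ i → i ∈ˡ xs → a i zero ≈ 1#) →
      Resolves (4 ℕ.* (L ℕ.+ L ℕ.* L)) (suc (Q ℕ.+ Q ℕ.* Q)) φ a xs X
    resolve φ lin oracle {I} a [] X _ = [] , X , 0ℤ , ([] , ℕ.z≤n) ,
      LargeBox-mono {B = 1} {C = suc (Q ℕ.+ Q ℕ.* Q)} {X = X} (ℕ.s≤s ℕ.z≤n) (LargeBox-refl {X = X}) ,
      λ _ ()
    resolve φ lin oracle {I} a xs@(_ ∷ _) X unit = cases (median b xs (here ≡.refl))
      where
      b : I → Carrier
      b i = a i (suc zero)

      module _ (μ : Carrier) where
        -- Elements equal to the median are included, so below `α` may vanish, whereas `β` is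
        -- strictly positive.
        us = filter (λ i → ¬? (μ <? b i)) xs
        es = filter (λ i → b i ≟ μ) xs
        vs = filter (λ i → μ <? b i) xs

        equal-case : Resolves L Q φ a es X
        equal-case with r (λ y → φ y ∘ embed μ) (λ y → Linear-embed μ (lin y)) (oracle ∘ embed μ)
                          (λ i → a i zero ∷ᵛ tail (tail (a i))) es X
        ... | ys , Y , t , lg , lb , eq = ys , Y , t , lg , lb , λ i i∈ y y∈ →
          let i∈xs , bi≈μ = ∈-filter⁻ (λ i → b i ≟ μ) {xs = xs} (⊆⇒∈ (proj₁ lg) i∈) in
          ≡.trans (sgn-cong (Linear-cong (lin y) _ _ λ
            { zero          → refl
            ; (suc zero)    → trans bi≈μ (sym (trans (*-congˡ (unit i i∈xs)) (*-identityʳ μ)))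
            ; (suc (suc j)) → refl })) (eq i i∈ y y∈)

        zs = zip vs us

        α β : I × I → Carrier
        α (_ , q) = μ + - b q
        β (p , _) = b p + - μ

        -- With α ≥ 0 and β > 0, (α + β) p = crossing + β difference and
        -- (α + β) q = crossing − α difference, so the signs of a functional at the
        -- difference and the crossing determine its sign at p or at q.
        difference : I × I → Vector Carrier (suc m)
        difference (p , q) j = 1# * a p (suc j) + - 1# * a q (suc j)

        crossing : I × I → Vector Carrier (suc m)
        crossing z@(p , q) = (α z * a p zero + β z * a q zero) ∷ᵛ
          λ j → α z * a p (suc (suc j)) + β z * a q (suc (suc j))

        module _ {p q} (z∈ : (p , q) ∈ˡ zs) where
          z : I × I
          z = p , q

          p∈ : p ∈ˡ xs × μ < b p
          p∈ = ∈-filter⁻ (λ i → μ <? b i) {xs = xs} (proj₁ (∈-zip vs us z∈))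

          q∈ : q ∈ˡ xs × ¬ μ < b q
          q∈ = ∈-filter⁻ (λ i → ¬? (μ <? b i)) {xs = xs} (proj₂ (∈-zip vs us z∈))

          0<β : 0# < β z
          0<β = x<y⇒0<y-x (proj₂ p∈)

          0≤α : 0# < α z ⊎ α z ≈ 0#
          0≤α with compare (b q) μ
          ... | tri< bq<μ _ _ = inj₁ (x<y⇒0<y-x bq<μ)
          ... | tri≈ _ bq≈μ _ = inj₂ (trans (+-congˡ (-‿cong bq≈μ)) (-‿inverseʳ μ))
          ... | tri> _ _ μ<bq = contradiction μ<bq (proj₂ q∈)

          0<α+β : 0# < α z + β z
          0<α+β with 0≤α
          ... | inj₁ 0<α = +-pos 0<α 0<β
          ... | inj₂ α≈0 with +-Signʳ α≈0 (pos 0<β)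
          ...   | pos r = r

          *ap : ∀ {x} → x * a p zero ≈ x
          *ap = trans (*-congˡ (unit p (proj₁ p∈))) (*-identityʳ _)

          *aq : ∀ {x} → x * a q zero ≈ x
          *aq = trans (*-congˡ (unit q (proj₁ q∈))) (*-identityʳ _)

          -- This places the crossing in the hyperplane x₁ = μ x₀: the weights are the distances of
          -- `b q` and `b p` from `μ`, and both sides equal `μ * (b p - b q)`.
          slope : μ * (α z * a p zero + β z * a q zero) ≈ α z * b p + β z * b q
          slope = begin
            μ * (α z * a p zero + β z * a q zero)           ≈⟨ *-congˡ (+-cong *ap *aq) ⟩
            μ * (α z + β z)                                 ≈⟨ lemma₁ μ (b p) (- μ) (- b q) ⟩
            (μ + - μ) * μ + (μ * b p + μ * - b q)            ≈⟨ +-congʳ (0#*x (-‿inverseʳ μ)) ⟩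
            0# + (μ * b p + μ * - b q)
              ≈⟨ +-cong (sym (0#*x (-‿inverseʳ (b q)))) (+-congˡ (trans (sym (-‿distribʳ-* μ (b q))) (-‿distribˡ-* μ (b q)))) ⟩
            (b q + - b q) * b p + (μ * b p + - μ * b q)      ≈⟨ lemma₂ μ (b p) (b q) (- μ) (- b q) ⟩
            α z * b p + β z * b q                           ∎
            where
            open ≈
            lemma₁ : ∀ μ p nμ nq → μ * ((μ + nq) + (p + nμ)) ≈ (μ + nμ) * μ + (μ * p + μ * nq)
            lemma₁ = solve 4 (λ μ p nμ nq →
              μ :* ((μ :+ nq) :+ (p :+ nμ)) := (μ :+ nμ) :* μ :+ (μ :* p :+ μ :* nq)) refl
            lemma₂ : ∀ μ p q nμ nq → (q + nq) * p + (μ * p + nμ * q) ≈ (μ + nq) * p + (p + nμ) * q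
            lemma₂ = solve 5 (λ μ p q nμ nq →
              (q :+ nq) :* p :+ (μ :* p :+ nμ :* q) := (μ :+ nq) :* p :+ (p :+ nμ) :* q) refl

          module _ {g : Vector Carrier (suc (suc m)) → Carrier} (ling : Linear g) where
            f₁ f₂ : Carrier
            f₁ = 1# * g (a p) + - 1# * g (a q)
            f₂ = α z * g (a p) + β z * g (a q)

            g-difference : g (embed₀ (difference z)) ≈ f₁
            g-difference = ling 1# (- 1#) _ _ _ λ
              { zero    → sym (trans (+-cong *ap *aq) (-‿inverseʳ 1#))
              ; (suc j) → refl }

            g-crossing : g (embed μ (crossing z)) ≈ f₂
            g-crossing = ling (α z) (β z) _ _ _ λ
              { zero          → refl
              ; (suc zero)    → slope
              ; (suc (suc j)) → refl }

            upper : ∀ {s} → Sign (f₂ + β z * f₁) s → sgn (g (a p)) ≡ s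
            upper S = Sign-*⁻ 0<α+β (Sign-resp (sym (interpolate (α z) (β z) (g (a p)) (g (a q)))) S)

            lower : ∀ {s} → Sign (f₂ + α z * (- 1# * f₁)) s → sgn (g (a q)) ≡ s
            lower S = Sign-*⁻ 0<α+β (Sign-resp (sym (interpolate′ (α z) (β z) (g (a p)) (g (a q)))) S)

            lower′ : ∀ {s} → Sign f₂ s → Sign (- 1# * f₁) s → sgn (g (a q)) ≡ s
            lower′ S T with 0≤α
            ... | inj₁ 0<α = lower (+-Sign S (*-Sign⁺ 0<α T))
            ... | inj₂ α≈0 = lower (+-Signˡ S (0#*x α≈0))

            opposite : ∀ {x y s t} → Sign x s → Sign y t → s ≢ 0ℤ → t ≢ 0ℤ → s ≢ t → Sign (- 1# * x) t
            opposite (pos p)  (neg _)  _ _ _ = *-Sign (neg (pos⇒ 0<1)) (pos p)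
            opposite (neg p)  (pos _)  _ _ _ = *-Sign (neg (pos⇒ 0<1)) (neg p)
            opposite (pos _)  (pos _)  _ _ n = contradiction ≡.refl n
            opposite (neg _)  (neg _)  _ _ n = contradiction ≡.refl n
            opposite (null _) _        n _ _ = contradiction ≡.refl n
            opposite (pos _)  (null _) _ n _ = contradiction ≡.refl n
            opposite (neg _)  (null _) _ n _ = contradiction ≡.refl n

        Decision : (I × I → I) → ℤ → ℤ → ℤ → Set _
        Decision π s s₁ s₂ = ∀ {p q} (z∈ : (p , q) ∈ˡ zs) {g} (ling : Linear g) →
          Sign (f₁ z∈ ling) s₁ → Sign (f₂ z∈ ling) s₂ → sgn (g (a (π (p , q)))) ≡ s

        -- The sign at `q` is the one found when `s₁` and `s₂` are nonzero and opposite, the sign at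
        -- `p` in all other cases. The choice depends on the two signs alone, so one projection
        -- serves all surviving pairs and yields a sublist.
        decide : ∀ (s₁ s₂ : ℤ) → ∃[ s ] (Decision proj₁ s s₁ s₂ ⊎ Decision proj₂ s s₁ s₂)
        decide s₁ s₂ with s₁ ℤ.≟ 0ℤ | s₂ ℤ.≟ 0ℤ | s₁ ℤ.≟ s₂
        ... | yes ≡.refl | _ | _ = s₂ , inj₁ λ z∈ ling S₁ S₂ →
          upper z∈ ling (+-Signˡ S₂ (trans (*-congˡ (Sign-null S₁)) (zeroʳ _)))
        ... | no _ | yes ≡.refl | _ = s₁ , inj₁ λ z∈ ling S₁ S₂ →
          upper z∈ ling (+-Signʳ (Sign-null S₂) (*-Sign⁺ (0<β z∈) S₁))
        ... | no _ | no _ | yes ≡.refl = s₂ , inj₁ λ z∈ ling S₁ S₂ →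
          upper z∈ ling (+-Sign S₂ (*-Sign⁺ (0<β z∈) S₁))
        ... | no s₁≢0 | no s₂≢0 | no s₁≢s₂ = s₂ , inj₂ λ z∈ ling S₁ S₂ →
          lower′ z∈ ling S₂ (opposite z∈ ling S₁ S₂ s₁≢0 s₂≢0 s₁≢s₂)

        pair-case : length xs ℕ.≤ 4 ℕ.* length zs → Resolves (4 ℕ.* (L ℕ.* L)) (Q ℕ.* Q) φ a xs X
        pair-case n≤
          with r (λ y → φ y ∘ embed₀) (λ y → Linear-embed₀ (lin y)) (oracle ∘ embed₀) difference zs X
        ... | ws , Y , s₁ , lg , lb , eq
          with r (λ y → φ y ∘ embed μ) (λ y → Linear-embed μ (lin y)) (oracle ∘ embed μ) crossing ws Y
        ...   | ws′ , Y′ , s₂ , lg′ , lb′ , eq′ with decide s₁ s₂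
        ...     | s , d = choose d
          where
          large : Large (L ℕ.* L) zs ws′
          large = Large-trans {B = L} {L} lg lg′

          result : ∀ π → map π zs ⊆ xs → Decision π s s₁ s₂ → Resolves (4 ℕ.* (L ℕ.* L)) (Q ℕ.* Q) φ a xs X
          result π sub dec = map π ws′ , Y′ , s ,
            ( ⊆-trans (map⁺ π (proj₁ large)) sub
            , ℕ.≤-trans n≤ (ℕ.≤-trans (ℕ.*-monoʳ-≤ 4 (proj₂ large)) (ℕ.≤-reflexive
                (≡.trans (≡.sym (ℕ.*-assoc 4 (L ℕ.* L) (length ws′)))
                  (≡.cong (4 ℕ.* (L ℕ.* L) ℕ.*_) (≡.sym (length-map π ws′))))))) ,
            LargeBox-trans {B = Q} {Q} {X = X} {Y} {Y′} lb lb′ , known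
            where
            known : ∀ i → i ∈ˡ map π ws′ → ∀ y → y ∈ᵇ Y′ → sgn (φ y (a i)) ≡ s
            known i i∈ y y∈ with ∈-map⁻ π i∈
            ... | (p , q) , z∈ws′ , ≡.refl = dec z∈ (lin y)
              (Sign-resp (g-difference z∈ (lin y))
                (sgn⇒Sign (eq _ (⊆⇒∈ (proj₁ lg′) z∈ws′) y (LargeBox-∈ {B = Q} {X = Y} {Y′} lb′ y∈))))
              (Sign-resp (g-crossing z∈ (lin y)) (sgn⇒Sign (eq′ _ z∈ws′ y y∈)))
              where z∈ = ⊆⇒∈ (proj₁ large) z∈ws′

          choose : Decision proj₁ s s₁ s₂ ⊎ Decision proj₂ s s₁ s₂ →
                   Resolves (4 ℕ.* (L ℕ.* L)) (Q ℕ.* Q) φ a xs X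
          choose (inj₁ d) = result proj₁ (⊆-trans (zip-proj₁ vs us) (filter-⊆ (λ i → μ <? b i) xs)) d
          choose (inj₂ d) = result proj₂ (⊆-trans (zip-proj₂ vs us) (filter-⊆ (λ i → ¬? (μ <? b i)) xs)) d

      weaken : ∀ {B Q′} → B ℕ.≤ 4 ℕ.* (L ℕ.+ L ℕ.* L) → Q′ ℕ.≤ suc (Q ℕ.+ Q ℕ.* Q) →
               Resolves B Q′ φ a xs X → Resolves (4 ℕ.* (L ℕ.+ L ℕ.* L)) (suc (Q ℕ.+ Q ℕ.* Q)) φ a xs X
      weaken {B} {Q′} B≤ Q′≤ (ys , Y , s , lg , lb , eq) =
        ys , Y , s , Large-mono {B = B} B≤ lg , LargeBox-mono {B = Q′} {X = X} {Y} Q′≤ lb , eq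

      cases : _ → Resolves (4 ℕ.* (L ℕ.+ L ℕ.* L)) (suc (Q ℕ.+ Q ℕ.* Q)) φ a xs X
      cases (μ , below , above)
        with ≤-half {length (filter (λ i → ¬? (b i <? μ)) xs)} {length (es μ)}
               (length-filter-⊎ (λ i → ¬? (b i <? μ)) (λ i → b i ≟ μ) (λ i → μ <? b i) xs λ i _ → split i)
        where
        split : ∀ i → ¬ b i < μ → b i ≈ μ ⊎ μ < b i
        split i ≮ with compare (b i) μ
        ... | tri< lt _ _ = contradiction lt ≮
        ... | tri≈ _ eq _ = inj₁ eq
        ... | tri> _ _ gt = inj₂ gt
      ... | inj₁ es≥ = weaken {4 ℕ.* L} {Q} (ℕ.*-monoʳ-≤ 4 (ℕ.m≤m+n L _)) (ℕ.m≤n⇒m≤1+n (ℕ.m≤m+n Q _))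
                         (enlarge (equal-case μ))
        where
        enlarge : Resolves L Q φ a (es μ) X → Resolves (4 ℕ.* L) Q φ a xs X
        enlarge (ys , Y , s , lg , rest) = ys , Y , s ,
          Large-trans {B = 4} {L} (filter-⊆ (λ i → b i ≟ μ) xs , ≤-quarter (length (es μ)) above es≥) lg , rest
      ... | inj₂ vs≥ = weaken {4 ℕ.* (L ℕ.* L)} {Q ℕ.* Q}
                         (ℕ.*-monoʳ-≤ 4 (ℕ.m≤n+m (L ℕ.* L) L)) (ℕ.m≤n⇒m≤1+n (ℕ.m≤n+m _ Q))
                         (pair-case μ enough)
        where
        -- The shorter list decides the number of pairs: `vs` has at least a quarter of the vectors
        -- and `us` at least half.
        enough : length xs ℕ.≤ 4 ℕ.* length (zs μ)
        enough = ℕ.≤-trans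
          (ℕ.⊓-glb (≤-quarter (length (vs μ)) above vs≥)
                   (ℕ.≤-trans below (ℕ.*-monoˡ-≤ (length (us μ)) {2} {4} (ℕ.s≤s (ℕ.s≤s ℕ.z≤n)))))
          (ℕ.≤-reflexive (≡.trans (≡.sym (ℕ.*-distribˡ-⊓ 4 (length (vs μ)) (length (us μ))))
            (≡.cong (4 ℕ.*_) (≡.sym (length-zipWith _,_ (vs μ) (us μ))))))

  search : ∀ m → Search m
  search¹ : ∀ m → Search¹ m
  search zero          = search-zero
  search (suc m)       = search-suc (search m) (search¹ m)
  search¹ zero         = search¹-zero
  search¹ (suc m)      = search¹-suc (search (suc m))

  -- Homogeneous boxes for multilinear forms.

  infix 4 _≋_
  _≋_ : Vector Carrier m → Vector Carrier m → Set ℓ₁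
  u ≋ v = ∀ j → u j ≈ v j

  LinearAt : Fin k → ((Fin k → Vector Carrier D) → Carrier) → Set _
  LinearAt i f = ∀ α β x y z → (∀ j → j ≢ i → x j ≋ y j) → (∀ j → j ≢ i → x j ≋ z j) →
    (∀ l → x i l ≈ α * y i l + β * z i l) → f x ≈ α * f y + β * f z

  ConstantAt : Fin k → ((Fin k → Vector Carrier D) → Carrier) → Set _
  ConstantAt i f = ∀ x y → (∀ j → j ≢ i → x j ≋ y j) → f x ≈ f y

  record Multilinear (f : (Fin k → Vector Carrier D) → Carrier) : Set (c Level.⊔ ℓ₁) where
    field
      congruent : ∀ x y → (∀ j → x j ≋ y j) → f x ≈ f y
      each      : ∀ i → LinearAt i f ⊎ ConstantAt i f

  open Multilinear

  restrict : ∀ {f : (Fin (suc k) → Vector Carrier D) → Carrier} v →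
             Multilinear f → Multilinear (λ x → f (v ∷ᵛ x))
  restrict v ml .congruent x y e = congruent ml _ _ λ { zero l → refl ; (suc j) → e j }
  restrict v ml .each i = Sum.map
    (λ lin α β x y z e₁ e₂ e → lin α β _ _ _
      (λ { zero _ l → refl ; (suc j) n → e₁ j (≢-suc n) })
      (λ { zero _ l → refl ; (suc j) n → e₂ j (≢-suc n) }) e)
    (λ con x y e → con _ _ λ { zero _ l → refl ; (suc j) n → e j (≢-suc n) })
    (each ml (suc i))
    where
    ≢-suc : ∀ {j} → Fin.suc j ≢ suc i → j ≢ i
    ≢-suc n e = n (≡.cong suc e)

  Homogenises : ℕ → {A : Set} → ((Fin k → A) → ℤ) → Set
  Homogenises {k = k} K {A} τ = ∀ (X : Box A k) → ∃[ Y ] ∃[ s ]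
    (LargeBox K X Y × (∀ y → y ∈ᵇ Y → τ y ≡ s))

  homogenise : ∀ k D → ∃[ K ] (∀ {A : Set} (a : A → Vector Carrier D)
    (f : (Fin k → Vector Carrier D) → Carrier) →
    Multilinear f → Homogenises K (λ y → sgn (f (a ∘ y))))
  homogenise zero D = 1 , λ a f ml X → X , sgn (f λ ()) , (λ ()) , λ y _ → sgn-cong (congruent ml _ _ λ ())
  homogenise (suc k) D with homogenise k D
  ... | K , h with search D K
  ...   | L , Q , r = L ℕ.+ (Q ℕ.+ suc K) , go
    where
    -- One bound for every side: `L` for the first and `Q` for the others in the linear case, `K` in
    -- the constant case. There the first side is kept whole, for which `suc` guarantees a bound of
    -- at least 1.
    B = L ℕ.+ (Q ℕ.+ suc K)
    L≤ : L ℕ.≤ B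
    L≤ = ℕ.m≤m+n L _
    Q≤ : Q ℕ.≤ B
    Q≤ = ℕ.≤-trans (ℕ.m≤m+n Q _) (ℕ.m≤n+m _ L)
    1+K≤ : suc K ℕ.≤ B
    1+K≤ = ℕ.≤-trans (ℕ.m≤n+m (suc K) Q) (ℕ.m≤n+m _ L)

    go : ∀ {A : Set} (a : A → Vector Carrier D) f → Multilinear f → Homogenises B (λ y → sgn (f (a ∘ y)))
    go a f ml X with each ml zero
    ... | inj₁ lin with r (λ y v → f (v ∷ᵛ a ∘ y))
                       (λ y α β u v w e → lin α β _ _ _
                         (λ { zero n → contradiction ≡.refl n ; (suc j) _ l → refl })
                         (λ { zero n → contradiction ≡.refl n ; (suc j) _ l → refl }) e)
                       (λ v → h a (λ x → f (v ∷ᵛ x)) (restrict v ml)) a (X zero) (tail X)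
    ...   | ys , Y , s , lg , lb , eq = ys ∷ᵛ Y , s ,
      (λ { zero → Large-mono {B = L} L≤ lg ; (suc i) → Large-mono {B = Q} Q≤ (lb i) }) ,
      λ y y∈ → ≡.trans (sgn-cong (congruent ml _ _ λ { zero l → refl ; (suc j) l → refl }))
                       (eq (y zero) (y∈ zero) (tail y) (λ i → y∈ (suc i)))
    -- The zero vector merely fills the argument that the form ignores.
    go a f ml X | inj₂ con with h a (λ x → f ((λ _ → 0#) ∷ᵛ x)) (restrict _ ml) (tail X)
    ... | Y , s , lb , eq = X zero ∷ᵛ Y , s ,
      (λ { zero → Large-mono {B = 1} (ℕ.≤-trans (ℕ.s≤s ℕ.z≤n) 1+K≤) Large-refl
         ; (suc i) → Large-mono {B = K} (ℕ.≤-trans (ℕ.n≤1+n K) 1+K≤) (lb i) }) ,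
      λ y y∈ → ≡.trans (sgn-cong (con _ _ λ { zero n → contradiction ≡.refl n ; (suc j) _ l → refl }))
                       (eq (tail y) (λ i → y∈ (suc i)))

  -- Determinants as multilinear forms.

  sum-linear : ∀ α β {f g h : Vector Carrier n} → (∀ j → f j ≈ α * g j + β * h j) →
               sum f ≈ α * sum g + β * sum h
  sum-linear α β {f} {g} {h} e = trans (sum-cong-≋ {x = f} {λ j → α * g j + β * h j} e)
    (trans (∑-distrib-+ (λ j → α * g j) (λ j → β * h j))
      (+-cong (sym (*-distribˡ-sum α g)) (sym (*-distribˡ-sum β h))))

  det-cong : ∀ {M N : Matrix n} → (∀ i → M i ≋ N i) → det M ≈ det N
  det-cong {zero}  e = refl
  det-cong {suc n} e = sum-cong-≋ λ j →
    *-cong (*-congˡ {x = (- 1#) ^ toℕ j} (e zero j)) (det-cong λ i l → e (suc i) (punchIn j l))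

  det-linear : ∀ {n} (i : Fin n) α β {M N O : Matrix n} →
    (∀ j → j ≢ i → M j ≋ N j) → (∀ j → j ≢ i → M j ≋ O j) →
    (∀ l → M i l ≈ α * N i l + β * O i l) → det M ≈ α * det N + β * det O
  det-linear zero α β {M} {N} {O} e₁ e₂ e = sum-linear α β λ j → trans
    (*-congʳ (*-congˡ {x = (- 1#) ^ toℕ j} (e j))) (trans (lemma ((- 1#) ^ toℕ j) α β (N zero j) (O zero j) _)
    (+-cong (*-congˡ (*-congˡ (det-cong λ r l → e₁ (suc r) (λ ()) (punchIn j l))))
            (*-congˡ (*-congˡ (det-cong λ r l → e₂ (suc r) (λ ()) (punchIn j l))))))
    where
    lemma : ∀ s α β u v d → s * (α * u + β * v) * d ≈ α * (s * u * d) + β * (s * v * d)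
    lemma = solve 6 (λ s α β u v d →
      s :* (α :* u :+ β :* v) :* d := α :* (s :* u :* d) :+ β :* (s :* v :* d)) refl
  det-linear (suc i) α β {M} {N} {O} e₁ e₂ e = sum-linear α β λ j → trans
    (*-congˡ (det-linear i α β (λ r n l → e₁ (suc r) (n ∘ Fin.suc-injective) (punchIn j l))
                               (λ r n l → e₂ (suc r) (n ∘ Fin.suc-injective) (punchIn j l))
                               (λ l → e (punchIn j l))))
    (trans (lemma ((- 1#) ^ toℕ j * M zero j) α β _ _)
    (+-cong (*-congˡ (*-congʳ (*-congˡ {x = (- 1#) ^ toℕ j} (e₁ zero (λ ()) j))))
                                     (*-congˡ (*-congʳ (*-congˡ {x = (- 1#) ^ toℕ j} (e₂ zero (λ ()) j))))))
    where
    lemma : ∀ s α β u v → s * (α * u + β * v) ≈ α * (s * u) + β * (s * v)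
    lemma = solve 5 (λ s α β u v → s :* (α :* u :+ β :* v) := α :* (s :* u) :+ β :* (s :* v)) refl

  -- Injectivity of `J` puts every argument into at most one row; an argument absent from all rows
  -- is one on which the form is constant.
  det-multilinear : ∀ (J : Fin D → Fin k) → Injective _≡_ _≡_ J →
                    Multilinear (λ (x : Fin k → Vector Carrier D) → det (x ∘ J))
  det-multilinear J inj .Multilinear.congruent x y e = det-cong (e ∘ J)
  det-multilinear J inj .Multilinear.each i with Fin.any? (λ r → J r Fin.≟ i)
  ... | yes (r , ≡.refl) = inj₁ λ α β x y z e₁ e₂ e → det-linear r α β
    (λ j n → e₁ (J j) (n ∘ inj)) (λ j n → e₂ (J j) (n ∘ inj)) e
  ... | no ¬∃ = inj₂ λ x y e → det-cong λ r → e (J r) λ eq → ¬∃ (r , eq)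

  -- All orientations at once.

  Increasing : (Fin m → Fin k) → Set
  Increasing J = J Preserves Fin._<_ ⟶ Fin._<_

  increasing? : ∀ (J : Fin m → Fin k) → Dec (Increasing J)
  increasing? J = map′ (λ f {i} {j} → f i j) (λ f i j → f {i} {j})
    (Fin.all? λ i → Fin.all? λ j → i Fin.<? j →-dec J i Fin.<? J j)

  Increasing⇒Injective : ∀ {J : Fin m → Fin k} → Increasing J → Injective _≡_ _≡_ J
  Increasing⇒Injective incr {i} {j} e with Fin.<-cmp i j
  ... | tri< i<j _ _ = contradiction e (Fin.<⇒≢ (incr i<j))
  ... | tri≈ _ i≡j _ = i≡j
  ... | tri> _ _ j<i = contradiction (≡.sym e) (Fin.<⇒≢ (incr j<i))

  functions : ∀ m k → List (Fin m → Fin k)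
  functions zero    k = []ᵛ ∷ []
  functions (suc m) k = cartesianProductWith _∷ᵛ_ (allFin k) (functions m k)

  functions-complete : ∀ m {k} (J : Fin m → Fin k) → ∃[ J′ ] (J′ ∈ˡ functions m k × J′ ≗ J)
  functions-complete zero    J = []ᵛ , here ≡.refl , λ ()
  functions-complete (suc m) J with functions-complete m (tail J)
  ... | J′ , J′∈ , e = J zero ∷ᵛ J′ , ∈-cartesianProductWith⁺ _∷ᵛ_ (∈-allFin (J zero)) J′∈ ,
    λ { zero → ≡.refl ; (suc i) → e i }

  homogeniseList : ∀ {T A : Set} K (τ : T → (Fin k → A) → ℤ) (ts : List T) →
    (∀ t → t ∈ˡ ts → Homogenises K (τ t)) → ∀ X → ∃[ Y ]
    (LargeBox (K ℕ.^ length ts) X Y × (∀ t → t ∈ˡ ts → ∀ x y → x ∈ᵇ Y → y ∈ᵇ Y → τ t x ≡ τ t y))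
  homogeniseList K τ []       h X = X , LargeBox-refl {X = X} , λ _ ()
  homogeniseList K τ (t ∷ ts) h X with h t (here ≡.refl) X
  ... | Y , s , lb , eq with homogeniseList K τ ts (λ t t∈ → h t (there t∈)) Y
  ...   | Z , lb′ , eq′ = Z , LargeBox-trans {B = K} {K ℕ.^ length ts} {X = X} {Y} {Z} lb lb′ , λ
    { t (here ≡.refl) x y x∈ y∈ → ≡.trans (eq x (sub x∈)) (≡.sym (eq y (sub y∈)))
    ; t (there t∈) → eq′ t t∈ }
    where
    sub : ∀ {x} → x ∈ᵇ Z → x ∈ᵇ Y
    sub = LargeBox-∈ {B = K ℕ.^ length ts} {X = Y} {Z} lb′

  -- Serves twice: with `D = suc d` for the orientations of the points and with `D = 2` for the
  -- coincidences of indices.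
  homogeniseDet : ∀ D k → ∃[ K ] (∀ {A : Set} (a : A → Vector Carrier D) (X : Box A k) → ∃[ Y ]
    (LargeBox K X Y × (∀ (J : Fin D → Fin k) → Increasing J → ∀ x y → x ∈ᵇ Y → y ∈ᵇ Y →
      sgn (det (a ∘ x ∘ J)) ≡ sgn (det (a ∘ y ∘ J)))))
  homogeniseDet D k with homogenise k D
  ... | K , h = K ℕ.^ length Js , go
    where
    Js = filter increasing? (functions D k)
    go : ∀ {A : Set} (a : A → Vector Carrier D) (X : Box A k) → ∃[ Y ]
      (LargeBox (K ℕ.^ length Js) X Y × (∀ (J : Fin D → Fin k) → Increasing J → ∀ x y → x ∈ᵇ Y → y ∈ᵇ Y →
        sgn (det (a ∘ x ∘ J)) ≡ sgn (det (a ∘ y ∘ J))))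
    go a X with homogeniseList K (λ J x → sgn (det (a ∘ x ∘ J))) Js
                (λ J J∈ → h a _ (det-multilinear J (Increasing⇒Injective
                  (proj₂ (∈-filter⁻ increasing? {xs = functions D k} J∈))))) X
    ... | Y , lb , eq = Y , lb , same
      where
      same : ∀ (J : Fin D → Fin k) → Increasing J → ∀ x y → x ∈ᵇ Y → y ∈ᵇ Y →
        sgn (det (a ∘ x ∘ J)) ≡ sgn (det (a ∘ y ∘ J))
      same J incr x y x∈ y∈ with functions-complete D J
      ... | J′ , J′∈ , e = ≡.trans (≡.sym (to x)) (≡.trans (eq J′ J′∈Js x y x∈ y∈) (to y))
        where
        J′∈Js : J′ ∈ˡ Js
        J′∈Js = ∈-filter⁺ increasing? J′∈ λ {i} {j} i<j →
          ≡.subst₂ Fin._<_ (≡.sym (e i)) (≡.sym (e j)) (incr i<j)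
        to : ∀ x → sgn (det (a ∘ x ∘ J′)) ≡ sgn (det (a ∘ x ∘ J))
        to x = sgn-cong (det-cong λ r l → reflexive (≡.cong (λ i → a (x i) l) (e r)))

  -- Natural numbers among the reals.

  ≤-trans : ∀ {x y z} → x ≤ y → y ≤ z → x ≤ z
  ≤-trans (inj₁ x<y) (inj₁ y<z) = inj₁ (<-trans x<y y<z)
  ≤-trans (inj₁ x<y) (inj₂ y≈z) = inj₁ (<-respʳ y≈z x<y)
  ≤-trans (inj₂ x≈y) (inj₁ y<z) = inj₁ (<-respˡ (sym x≈y) y<z)
  ≤-trans (inj₂ x≈y) (inj₂ y≈z) = inj₂ (trans x≈y y≈z)

  <⇒≱ : ∀ {x y} → x < y → ¬ y ≤ x
  <⇒≱ x<y (inj₁ y<x) = irrefl refl (<-trans x<y y<x)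
  <⇒≱ x<y (inj₂ y≈x) = irrefl (sym y≈x) x<y

  *-monoˡ-≤ : ∀ {x y z} → 0# < z → x ≤ y → z * x ≤ z * y
  *-monoˡ-≤ {z = z} 0<z (inj₂ x≈y) = inj₂ (*-congˡ x≈y)
  *-monoˡ-≤ {x} {y} {z} 0<z (inj₁ x<y) = inj₁ (0<y-x⇒x<y (<-respʳ e (*-pos 0<z (x<y⇒0<y-x x<y))))
    where
    e : z * (y + - x) ≈ z * y + - (z * x)
    e = trans (distribˡ z y (- x)) (+-congˡ (sym (-‿distribʳ-* z x)))

  fromℕ-<suc : ∀ n → fromℕ n < fromℕ (suc n)
  fromℕ-<suc n = <-respˡ (+-identityˡ (fromℕ n)) (+-monoˡ-< (fromℕ n) 0<1)

  fromℕ-mono-< : ∀ {m n} → m ℕ.< n → fromℕ m < fromℕ n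
  fromℕ-mono-< {m} {suc n} (ℕ.s≤s m≤n) with ℕ.m≤n⇒m<n∨m≡n m≤n
  ... | inj₁ m<n     = <-trans (fromℕ-mono-< m<n) (fromℕ-<suc n)
  ... | inj₂ ≡.refl = fromℕ-<suc m

  fromℕ-mono-≤ : ∀ {m n} → m ℕ.≤ n → fromℕ m ≤ fromℕ n
  fromℕ-mono-≤ m≤n with ℕ.m≤n⇒m<n∨m≡n m≤n
  ... | inj₁ m<n     = inj₁ (fromℕ-mono-< m<n)
  ... | inj₂ ≡.refl = inj₂ refl

  fromℕ-cancel-≤ : ∀ {m n} → fromℕ m ≤ fromℕ n → m ℕ.≤ n
  fromℕ-cancel-≤ {m} {n} p with m ℕ.≤? n
  ... | yes m≤n = m≤n
  ... | no m≰n  = contradiction p (<⇒≱ (fromℕ-mono-< (ℕ.≰⇒> m≰n)))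

  fromℕ-injective : ∀ {m n} → fromℕ m ≈ fromℕ n → m ≡ n
  fromℕ-injective e = ℕ.≤-antisym (fromℕ-cancel-≤ (inj₂ e)) (fromℕ-cancel-≤ (inj₂ (sym e)))

  inv-pos : ∀ {x} → 0# < x → 0# < inv x
  inv-pos {x} 0<x with inv x | inv-inverse (λ x≈0 → irrefl (sym x≈0) 0<x)
  ... | y | xy≈1 with compare 0# y
  ...   | tri< 0<y _ _ = 0<y
  ...   | tri≈ _ 0≈y _ = contradiction (trans (sym (zeroʳ x)) (trans (*-congˡ 0≈y) xy≈1)) 0≉1
  ...   | tri> _ _ y<0 with *-Sign (pos 0<x) (neg y<0)
  ...     | neg xy<0 = contradiction (<-trans 0<1 (<-respˡ xy≈1 xy<0)) (irrefl refl)

  -- The Archimedean axiom replaces `1 / δ` by a larger natural number, so that the counting can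
  -- take place in ℕ.
  large-multiple : ∀ {δ} → 0# < δ → ∃[ q ] (∀ m n → δ * fromℕ m ≤ fromℕ n → m ℕ.≤ q ℕ.* n)
  large-multiple {δ} 0<δ with archimedean (inv δ)
  ... | q , δ⁻¹<q = q , λ m n h → fromℕ-cancel-≤ (≤-trans (inj₂ (sym (cancel m)))
    (≤-trans (*-monoˡ-≤ (inv-pos 0<δ) h) (≤-trans (scale n) (inj₂ (sym (×1-homo-* q n))))))
    where
    cancel : ∀ m → inv δ * (δ * fromℕ m) ≈ fromℕ m
    cancel m = trans (sym (*-assoc _ _ _)) (trans (*-congʳ (trans (*-comm _ _)
      (inv-inverse (λ δ≈0 → irrefl (sym δ≈0) 0<δ)))) (*-identityˡ _))
    scale : ∀ n → inv δ * fromℕ n ≤ fromℕ q * fromℕ n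
    scale zero    = inj₂ (trans (zeroʳ _) (sym (zeroʳ _)))
    scale (suc n) = ≤-trans (inj₂ (*-comm _ _)) (≤-trans
      (*-monoˡ-≤ (fromℕ-mono-< {0} {suc n} (ℕ.s≤s ℕ.z≤n)) (inj₁ δ⁻¹<q)) (inj₂ (*-comm _ _)))

  reciprocal-≤ : ∀ {m n} s → m ℕ.≤ suc s ℕ.* n → inv (fromℕ (suc s)) * fromℕ m ≤ fromℕ n
  reciprocal-≤ {m} {n} s m≤ = ≤-trans
    (*-monoˡ-≤ (inv-pos 0<s) (≤-trans (fromℕ-mono-≤ m≤) (inj₂ (×1-homo-* (suc s) n))))
    (inj₂ (trans (sym (*-assoc _ _ _)) (trans (*-congʳ (trans (*-comm _ _)
      (inv-inverse (λ e → irrefl (sym e) 0<s)))) (*-identityˡ _))))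
    where
    0<s : 0# < fromℕ (suc s)
    0<s = fromℕ-mono-< {0} {suc s} (ℕ.s≤s ℕ.z≤n)

  -- Orientations of these points of the line turn x i ≡ x j into one more sign condition.
  onLine : Fin n → Vector Carrier 2
  onLine i = 1# ∷ᵛ (fromℕ (toℕ i) ∷ᵛ []ᵛ)

  det-onLine : ∀ (v : Fin 2 → Fin n) → det (onLine ∘ v) ≈ fromℕ (toℕ (v (suc zero))) + - fromℕ (toℕ (v zero))
  det-onLine v = begin
    1# * 1# * (1# * b * 1# + 0#) + (- 1# * 1# * a * (1# * 1# * 1# + 0#) + 0#)
      ≈⟨ +-cong (*-cong (*-identityˡ 1#) (trans (+-identityʳ _) (trans (*-identityʳ _) (*-identityˡ b))))
                (trans (+-identityʳ _) (*-cong (*-congʳ (*-identityʳ _))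
                  (trans (+-identityʳ _) (trans (*-identityʳ _) (*-identityˡ 1#))))) ⟩
    1# * b + - 1# * a * 1#
      ≈⟨ +-cong (*-identityˡ b) (trans (*-identityʳ _) (-1*x≈-x a)) ⟩
    b + - a ∎
    where
    open ≈
    a = fromℕ (toℕ (v zero))
    b = fromℕ (toℕ (v (suc zero)))

  sgn-onLine : ∀ (v : Fin 2 → Fin n) → sgn (det (onLine ∘ v)) ≡ 0ℤ → v zero ≡ v (suc zero)
  sgn-onLine v e = ≡.sym (Fin.toℕ-injective (fromℕ-injective (x∙y⁻¹≈ε⇒x≈y _ _
    (trans (sym (det-onLine v)) (sgn≡0⇒≈0 e)))))

  onLine-sgn : ∀ (v : Fin 2 → Fin n) → v zero ≡ v (suc zero) → sgn (det (onLine ∘ v)) ≡ 0ℤ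
  onLine-sgn v e = sgn-zero (trans (det-onLine v)
    (trans (+-congʳ (reflexive (≡.cong (fromℕ ∘ toℕ) (≡.sym e)))) (-‿inverseʳ _)))

  pair-increasing : ∀ {i j : Fin k} → i Fin.< j → Increasing (i ∷ᵛ (j ∷ᵛ []ᵛ))
  pair-increasing i<j {zero}     {suc zero} _            = i<j
  pair-increasing i<j {suc zero} {suc zero} (ℕ.s≤s ())

  ≋-refl : ∀ {u : Point d} → u ≋ u
  ≋-refl _ = refl

  χ-cong : (p q : Fin (suc d) → Point d) → (∀ i → p i ≋ q i) → χ p ≡ χ q
  χ-cong {d} p q e = sgn-cong (det-cong {suc d} {λ i → 1# ∷ᵛ p i} {λ i → 1# ∷ᵛ q i} λ i → λ
    { zero → refl ; (suc l) → e i l })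

  -- Copies as tuples of indices.

  module _ (P : PointSet d n) (ρ : PointSet d k) where

    -- The labelling of the copy is absorbed into the order of the tuple; only a labelling of `ρ`
    -- remains as a witness, and it can be passed on unchanged to another tuple.
    Copy : (Fin k → Fin n) → Set _
    Copy x = Injective _≡_ _≡_ x × Σ[ ℓ ∈ Labelling k (range (point ρ)) ]
      (∀ (I : Fin (suc d) → Fin k) → Increasing I → χ (point P ∘ x ∘ I) ≡ χ (label ℓ ∘ I))

    Copy-resp : ∀ {x y} → x ≗ y → Copy x → Copy y
    Copy-resp {x} {y} e (inj , ℓ , same) =
      (λ {i} {j} eq → inj (≡.trans (e i) (≡.trans eq (≡.sym (e j))))) , ℓ ,
      λ I incr → ≡.trans
        (χ-cong _ _ λ r l → reflexive (≡.cong (λ i → point P i l) (≡.sym (e (I r))))) (same I incr)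

    Copy⇒SameOrderType : ∀ {x} → Copy x → SameOrderType k (range (point P ∘ x)) (range (point ρ))
    Copy⇒SameOrderType {x} (inj , ℓ , same) = ℓA , ℓ , same
      where
      ℓA : Labelling k (range (point P ∘ x))
      ℓA = record
        { to = λ i → point P (x i) , i , ≋-refl
        ; cong = λ { ≡.refl → ≋-refl }
        ; bijective = (λ e → inj (Injection.injective P e)) ,
            λ { (q , i , e) → i , λ { ≡.refl → e } }
        }

    Image : Subset n → Vec (Fin n) k → Set
    Image S v = (∀ {j} → j ∈ S → ∃[ i ] lookup v i ≡ j) × (∀ i → lookup v i ∈ S)

    Image-unique : ∀ {S T v} → Image S v → Image T v → S ≡ T
    Image-unique {S} {T} {v} (onS , inS) (onT , inT) = ⊆-antisym (sub {v = v} onS inT) (sub {v = v} onT inS)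
      where
      sub : ∀ {S T : Subset n} {v : Vec (Fin n) k} →
        (∀ {j} → j ∈ S → ∃[ i ] lookup v i ≡ j) → (∀ i → lookup v i ∈ T) → S Subset.⊆ T
      sub {T = T} onS inT j∈S with onS j∈S
      ... | i , e = ≡.subst (_∈ T) e (inT i)

    copyTuple : ∀ {S} → SameOrderType k (P ↾ S) (range (point ρ)) → ∃[ v ] (Image S v × Copy (lookup v))
    copyTuple {S} (ℓA , ℓB , same) = tabulate x ,
      ( (λ {j} j∈ → proj₁ (onto j∈) , ≡.trans (look _) (proj₂ (onto j∈)))
      , λ i → ≡.subst (_∈ S) (≡.sym (look i)) (proj₁ (proj₂ (proj₂ (to i)))) ) ,
      Copy-resp (λ i → ≡.sym (look i))
        ( (λ {i} {j} e → injective (λ l → trans (sym (onPoint i l))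
             (trans (reflexive (≡.cong (λ s → point P s l) e)) (onPoint j l))))
        , ℓB
        , λ I incr → ≡.trans (χ-cong _ _ λ r → onPoint (I r)) (same I incr) )
      where
      open Bijection ℓA using (to; injective; surjective)
      x : Fin k → Fin n
      x i = proj₁ (proj₂ (to i))
      onPoint : ∀ i → point P (x i) ≋ proj₁ (to i)
      onPoint i = proj₂ (proj₂ (proj₂ (to i)))
      look : ∀ i → lookup (tabulate x) i ≡ x i
      look = Vec.lookup∘tabulate x
      onto : ∀ {j} → j ∈ S → ∃[ i ] x i ≡ j
      onto {j} j∈ with surjective (point P j , j , j∈ , ≋-refl)
      ... | i , e = i , Injection.injective P λ l → trans (onPoint i l) (e ≡.refl l)

    -- Each subset is represented by one ordering. It is recovered as the image of its tuple, so
    -- different subsets give different tuples; comparing `n ^ k` with `n C k` later pays for the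
    -- other orderings.
    copyTuples : ∀ {𝓢} → Unique 𝓢 →
      All (λ S → ∣ S ∣ ≡ k × SameOrderType k (P ↾ S) (range (point ρ))) 𝓢 →
      ∃[ vs ] (length vs ≡ length 𝓢 × Unique vs × (∀ v → v ∈ˡ vs → Copy (lookup v))
               × (∀ v → v ∈ˡ vs → ∃[ S ] (S ∈ˡ 𝓢 × Image S v)))
    copyTuples [] [] = [] , ≡.refl , [] , (λ _ ()) , λ _ ()
    copyTuples {S ∷ 𝓢} (S∉ ∷ uniq) ((_ , same) ∷ sames) with copyTuples uniq sames | copyTuple same
    ... | vs , l , uniq′ , copies , images | v , image , copy =
      v ∷ vs , ≡.cong suc l , All.tabulate fresh ∷ uniq′ ,
      (λ { _ (here ≡.refl) → copy ; w (there w∈) → copies w w∈ }) ,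
      λ { _ (here ≡.refl) → S , here ≡.refl , image
        ; w (there w∈) → let T , T∈ , image′ = images w w∈ in T , there T∈ , image′ }
      where
      fresh : ∀ {w} → w ∈ˡ vs → v ≢ w
      fresh w∈ ≡.refl with images _ w∈
      ... | T , T∈ , image′ = All.lookup S∉ T∈ (Image-unique {S} {T} {v} image image′)

  -- Being a copy depends on a tuple only through its coincidences and the orientations of its
  -- increasing subtuples. Once both are constant on the box, the labelling of `ρ` that fits one
  -- tuple fits all.
  homogeniseCopies : ∀ d k → ∃[ K ] (∀ {n} (P : PointSet d n) (ρ : PointSet d k) (X : Box (Fin n) k) →
    ∃[ Y ] (LargeBox K X Y × (∀ x y → x ∈ᵇ Y → y ∈ᵇ Y → Copy P ρ x → Copy P ρ y)))
  homogeniseCopies d k with homogeniseDet (suc d) k | homogeniseDet 2 k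
  ... | K₁ , h₁ | K₂ , h₂ = K₁ ℕ.* K₂ , go
    where
    go : ∀ {n} (P : PointSet d n) (ρ : PointSet d k) (X : Box (Fin n) k) →
      ∃[ Y ] (LargeBox (K₁ ℕ.* K₂) X Y × (∀ x y → x ∈ᵇ Y → y ∈ᵇ Y → Copy P ρ x → Copy P ρ y))
    go {n} P ρ X with h₁ (λ i → 1# ∷ᵛ point P i) X
    ... | Y , lb , same with h₂ onLine Y
    ...   | Z , lb′ , same′ = Z , LargeBox-trans {B = K₁} {K₂} {X = X} {Y} {Z} lb lb′ , transfer
      where
      sub : ∀ {x} → x ∈ᵇ Z → x ∈ᵇ Y
      sub = LargeBox-∈ {B = K₂} {X = Y} {Z} lb′

      coincide : ∀ {x y} → x ∈ᵇ Z → y ∈ᵇ Z → ∀ {i j} → i Fin.< j → y i ≡ y j → x i ≡ x j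
      coincide {x} {y} x∈ y∈ {i} {j} i<j e = sgn-onLine (x ∘ J)
        (≡.trans (same′ J (λ {a} {b} → pair-increasing i<j {a} {b}) x y x∈ y∈) (onLine-sgn (y ∘ J) e))
        where
        J : Fin 2 → Fin k
        J = i ∷ᵛ (j ∷ᵛ []ᵛ)

      transfer : ∀ x y → x ∈ᵇ Z → y ∈ᵇ Z → Copy P ρ x → Copy P ρ y
      transfer x y x∈ y∈ (inj , ℓ , χ≡) = injective , ℓ ,
        λ I incr → ≡.trans (same I incr y x (sub y∈) (sub x∈)) (χ≡ I incr)
        where
        injective : Injective _≡_ _≡_ y
        injective {i} {j} e with Fin.<-cmp i j
        ... | tri< i<j _ _ = inj (coincide x∈ y∈ i<j e)
        ... | tri≈ _ i≡j _ = i≡j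
        ... | tri> _ _ j<i = ≡.sym (inj (coincide x∈ y∈ j<i (≡.sym e)))

  -- From a big box of copies to disjoint sets.

  choose : ∀ {Y : Box (Fin n) k} → (∀ i → 0 ℕ.< length (Y i)) → ∃[ x ] x ∈ᵇ Y
  choose {Y = Y} 0< = (λ i → proj₁ (first (Y i) (0< i))) , λ i → proj₂ (first (Y i) (0< i))
    where
    first : ∀ {A : Set} (xs : List A) → 0 ℕ.< length xs → ∃[ x ] x ∈ˡ xs
    first (x ∷ _) _ = x , here ≡.refl

  module _ {X : Box (Fin n) k} {x} (x∈ : x ∈ᵇ X) {i j e} (i≢j : i ≢ j) (e∈i : e ∈ˡ X i) (e∈j : e ∈ˡ X j) where

    coincidence : ∃[ y ] (y ∈ᵇ X × y i ≡ y j)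
    coincidence = y , y∈ , y≡
      where
      y : Fin k → Fin n
      y l with l Fin.≟ i | l Fin.≟ j
      ... | yes _ | _     = e
      ... | no _  | yes _ = e
      ... | no _  | no _  = x l
      y∈ : y ∈ᵇ X
      y∈ l with l Fin.≟ i | l Fin.≟ j
      ... | yes ≡.refl | _          = e∈i
      ... | no _       | yes ≡.refl = e∈j
      ... | no _       | no _       = x∈ l
      y≡ : y i ≡ y j
      y≡ with i Fin.≟ i | i Fin.≟ j | j Fin.≟ i | j Fin.≟ j
      ... | no ≢  | _ | _     | _     = contradiction ≡.refl ≢
      ... | _     | _ | _     | no ≢  = contradiction ≡.refl ≢
      ... | yes _ | _ | yes _ | yes _ = ≡.refl
      ... | yes _ | _ | no _  | yes _ = ≡.refl

  module _ {k-1 n-1 : ℕ} where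
    private
      k′ = suc k-1
      n′ = suc n-1

    module _ (P : PointSet d n′) (ρ : PointSet d k′) where

      CopyBox : Box (Fin n′) k′ → Set _
      CopyBox Y = ∀ y → y ∈ᵇ Y → Copy P ρ y

      bigCopyBox : ∀ {K q S δ} →
        (∀ X → ∃[ Y ] (LargeBox K X Y × (∀ x y → x ∈ᵇ Y → y ∈ᵇ Y → Copy P ρ x → Copy P ρ y))) →
        (∀ m n → δ * fromℕ m ≤ fromℕ n → m ℕ.≤ q ℕ.* n) →
        ForcesBig _ k′ (K ℕ.^ k′) (powerBound k′ ℕ.* q) S →
        k′ ℕ.≤ n′ → AtLeastCopies δ P ρ →
        ∃[ Y ] (Y ⊑ full n′ × CopyBox Y × volume {k = k′} (full n′) ℕ.≤ S ℕ.* volume Y)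
      bigCopyBox {K} {q} {S} {δ} homogenise multiple dense k≤n (𝓢 , unique , all , δ≤) =
        fromTuples (copyTuples P ρ unique all)
        where
        fromTuples : ∃[ vs ] (length vs ≡ length 𝓢 × Unique vs × (∀ v → v ∈ˡ vs → Copy P ρ (lookup v))
               × (∀ v → v ∈ˡ vs → ∃[ S ] (S ∈ˡ 𝓢 × Image P ρ S v))) →
          ∃[ Y ] (Y ⊑ full n′ × CopyBox Y × volume {k = k′} (full n′) ℕ.≤ S ℕ.* volume Y)
        fromTuples (vs , vs≡ , vs-unique , copies , _) =
          dense E (multiplicity-unique _≟ᵛ_ vs-unique) CopyBox dichotomy (full n′) 0<volume enough
          where
          _≟ᵛ_ : DecidableEquality (Vec (Fin n′) k′)
          _≟ᵛ_ = Vec.≡-dec Fin._≟_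
          open DecMembership (Fin._≟_ {n′}) using (_∈?_)

          E : Vec (Fin n′) k′ → ℕ
          E = multiplicity _≟ᵛ_ vs

          inside? : ∀ (Y : Box (Fin n′) k′) (v : Vec (Fin n′) k′) → Dec (lookup v ∈ᵇ Y)
          inside? Y v = Fin.all? λ i → lookup v i ∈? Y i

          dichotomy : ∀ X → ∃[ Y ] (Y ⊑ X × volume X ℕ.≤ suc (K ℕ.^ k′) ℕ.* volume Y ×
            (CopyBox Y ⊎ count Y E ≡ 0))
          dichotomy X = let Y , lb , same = homogenise X in
            Y , (λ i → proj₁ (lb i)) ,
            ℕ.≤-trans (volume-large {B = K} X Y lb) (ℕ.m≤n+m _ (volume Y)) , decide Y same
            where
            decide : ∀ Y → (∀ x y → x ∈ᵇ Y → y ∈ᵇ Y → Copy P ρ x → Copy P ρ y) → CopyBox Y ⊎ count Y E ≡ 0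
            -- Only the listed tuples are inspected. If one lies in `Y`, all of `Y` consists of
            -- copies; otherwise the weight `E` vanishes on `Y`, even if unlisted copies occur
            -- there.
            decide Y same with Any.any? (inside? Y) vs
            ... | yes any = let v , v∈vs , v∈Y = find any in
                            inj₁ λ y y∈ → same (lookup v) y v∈Y y∈ (copies v v∈vs)
            ... | no none = inj₂ (ℕ.n≤0⇒n≡0 (ℕ.≤-trans
              (count-mono Y λ v v∈Y → ℕ.≤-reflexive (multiplicity-∉ _≟ᵛ_ {vs} {v} λ v∈vs →
                none (lose {P = λ v → lookup v ∈ᵇ Y} v∈vs v∈Y)))
              (ℕ.≤-reflexive (count-0 Y))))

          0<volume : 0 ℕ.< volume {k = k′} (full n′)
          0<volume = ≡.subst (0 ℕ.<_) (≡.sym (volume-full n′ k′)) (ℕ.m^n>0 n′ k′)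

          enough : volume {k = k′} (full n′) ℕ.≤ powerBound k′ ℕ.* q ℕ.* count (full n′) E
          enough = begin
            volume {k = k′} (full n′)                ≡⟨ volume-full n′ k′ ⟩
            n′ ℕ.^ k′                                ≤⟨ n^k≤nCk k≤n ⟩
            powerBound k′ ℕ.* (n′ C k′)
              ≤⟨ ℕ.*-monoʳ-≤ (powerBound k′) (multiple (n′ C k′) (length 𝓢) δ≤) ⟩
            powerBound k′ ℕ.* (q ℕ.* length 𝓢)       ≡⟨ ℕ.*-assoc (powerBound k′) q (length 𝓢) ⟨
            powerBound k′ ℕ.* q ℕ.* length 𝓢         ≡⟨ ≡.cong (powerBound k′ ℕ.* q ℕ.*_) vs≡ ⟨
            powerBound k′ ℕ.* q ℕ.* length vs        ≤⟨ ℕ.*-monoʳ-≤ (powerBound k′ ℕ.* q)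
                 (count-multiplicity _≟ᵛ_ (full n′) vs λ v _ i → ∈-allFin (lookup v i)) ⟩
            powerBound k′ ℕ.* q ℕ.* count (full n′) E ∎
            where open ℕ.≤-Reasoning

    module _ {Y : Box (Fin n′) k′} (Y⊑ : Y ⊑ full n′) {S : ℕ}
             (large : volume {k = k′} (full n′) ℕ.≤ S ℕ.* volume Y) where

      side-large : ∀ i → n′ ℕ.≤ S ℕ.* length (Y i)
      side-large i = ℕ.*-cancelʳ-≤ n′ (S ℕ.* length (Y i)) (n′ ℕ.^ k-1) {{ℕ.m^n≢0 n′ k-1}} (begin
        n′ ℕ.* n′ ℕ.^ k-1                      ≡⟨ volume-full n′ k′ ⟨
        volume {k = k′} (full n′)              ≤⟨ large ⟩
        S ℕ.* volume Y                         ≤⟨ ℕ.*-monoʳ-≤ S (volume-side Y short i) ⟩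
        S ℕ.* (length (Y i) ℕ.* n′ ℕ.^ k-1)    ≡⟨ ℕ.*-assoc S (length (Y i)) (n′ ℕ.^ k-1) ⟨
        S ℕ.* length (Y i) ℕ.* n′ ℕ.^ k-1      ∎)
        where
        open ℕ.≤-Reasoning
        short : ∀ i → length (Y i) ℕ.≤ n′
        short i = ℕ.≤-trans (length-mono-≤ (Y⊑ i)) (ℕ.≤-reflexive (length-tabulate {n = n′} id))

      side-nonempty : ∀ i → 0 ℕ.< length (Y i)
      side-nonempty i with length (Y i) | side-large i
      ... | zero  | p = contradiction (ℕ.≤-trans p (ℕ.≤-reflexive (ℕ.*-zeroʳ S))) λ ()
      ... | suc _ | _ = ℕ.s≤s ℕ.z≤n

      -- A point common to two sides could be put into both places, and the other places filled from
      -- the nonempty remaining sides, giving a tuple of the box that is not injective.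
      disjoint : (∀ y → y ∈ᵇ Y → Injective _≡_ _≡_ y) →
                 ∀ i j → i ≢ j → Empty (toSubset id (Y⊑ i) ∩ toSubset id (Y⊑ j))
      disjoint inj i j i≢j (e , e∈) =
        let e∈i , e∈j = x∈p∩q⁻ (toSubset id (Y⊑ i)) (toSubset id (Y⊑ j)) e∈
            x , x∈ = choose side-nonempty
            y , y∈ , y≡ = coincidence x∈ i≢j (∈-toSubset id (Y⊑ i) e∈i) (∈-toSubset id (Y⊑ j) e∈j)
        in i≢j (inj y y∈ y≡)

      subset-large : ∀ i → inv (fromℕ (suc S)) * fromℕ n′ ≤ fromℕ ∣ toSubset id (Y⊑ i) ∣
      subset-large i = reciprocal-≤ {n′} {∣ toSubset id (Y⊑ i) ∣} S
        (≡.subst (λ l → n′ ℕ.≤ suc S ℕ.* l) (≡.sym (∣toSubset∣ id (Y⊑ i)))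
          (ℕ.≤-trans (side-large i) (ℕ.*-monoˡ-≤ (length (Y i)) (ℕ.n≤1+n S))))

    copySets : ∀ (P : PointSet d n′) (ρ : PointSet d k′) {S} →
      ∃[ Y ] (Y ⊑ full n′ × CopyBox P ρ Y × volume {k = k′} (full n′) ℕ.≤ S ℕ.* volume Y) →
      Σ[ X ∈ (Fin k′ → Subset n′) ]
      ( (∀ (i j : Fin k′) → i ≢ j → Empty (X i ∩ X j))
      × (∀ i → inv (fromℕ (suc S)) * fromℕ n′ ≤ fromℕ ∣ X i ∣)
      × (∀ (x : Fin k′ → Fin n′) → (∀ i → x i ∈ X i) →
      SameOrderType k′ (range (point P ∘ x)) (range (point ρ))) )
    copySets P ρ {S} (Y , Y⊑ , copy , large) =
      (λ i → toSubset id (Y⊑ i)) ,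
      disjoint Y⊑ {S} large (λ y y∈ → proj₁ (copy y y∈)) ,
      subset-large Y⊑ {S} large ,
      λ x x∈ → Copy⇒SameOrderType P ρ (copy x λ i → ∈-toSubset id (Y⊑ i) (x∈ i))

proposition1 :
  ∀ {c ℓ₁ ℓ₂} (R : Reals c ℓ₁ ℓ₂) →
  let open Reals R
      open Geometry R in
  ∀ (d k : ℕ) → 1 ℕ.≤ d → 1 ℕ.≤ k →
  ∀ (δ : Carrier) → 0# < δ →
  Σ[ c̃ ∈ Carrier ] (0# < c̃ ×
    (∀ (n : ℕ) → k ℕ.≤ n →
     ∀ (P : PointSet d n) (ρ : PointSet d k) →
     GeneralPosition P → GeneralPosition ρ →
     AtLeastCopies δ P ρ →
     Σ[ X ∈ (Fin k → Subset n) ]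
       ( (∀ (i j : Fin k) → i ≢ j → Empty (X i ∩ X j))
       × (∀ i → c̃ * fromℕ n ≤ fromℕ ∣ X i ∣)
       × (∀ (x : Fin k → Fin n) → (∀ i → x i ∈ X i) →
            SameOrderType k (range (point P ∘ x)) (range (point ρ))) )))
proposition1 {c} {ℓ₁} R d k@(suc k-1) _ _ δ 0<δ =
  -- Every side has at least `n / S` points; `suc S` is positive by its form and can therefore be
  -- inverted at once.
  inv R (fromℕ (suc S)) , inv-pos R (fromℕ-mono-< R {0} {suc S} (ℕ.s≤s ℕ.z≤n)) ,
  λ { (suc _) k≤n P ρ _ _ copies →
      copySets R P ρ {S} (bigCopyBox R P ρ {K} {q} {S} (homogenised P ρ) multiple dense k≤n copies) }
  where
  open Reals R using (fromℕ)
  K = proj₁ (homogeniseCopies R d k)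
  homogenised = proj₂ (homogeniseCopies R d k)
  q = proj₁ (large-multiple R 0<δ)
  multiple = proj₂ (large-multiple R 0<δ)
  S = proj₁ (dense⇒big (c ⊔ ℓ₁) k (K ℕ.^ k) (powerBound k ℕ.* q))
  dense = proj₂ (dense⇒big (c ⊔ ℓ₁) k (K ℕ.^ k) (powerBound k ℕ.* q))
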